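{- Let $m,n$ be positive integers and let $k\ge 2$ be an integer. Let $P\in\mathbb{R}[x_1,\ldots,x_n]$ be a polynomial that has zeros of multiplicity at least $k$ at all points of $mB^n\setminus\{\mathbf{0}\}$ and a zero of multiplicity exactly $l$ at $\mathbf{0}$. (i) If $l=k-1$, then $\deg P\ge mn+(m+1)(k-1)$. (ii) If $l\le k-2$, $k\in\{2,3,4\}$ and $n\ge k-1$, then $\deg P\ge mn+(m+1)(k-1)-1$. Furthermore, in both cases there exists such a polynomial $P$ whose degree equals the respective lower bound.
   Context: $mB^n=\{0,1,\ldots,m\}^n\subseteq\mathbb{R}^n$ and $\mathbf{0}$ is the origin. For a polynomial $f\in\mathbb{R}[x_1,\ldots,x_n]$ and $\mathbf{a}=(a_1,\ldots,a_n)\in\mathbb{R}^n$, the multiplicity of $f$ at $\mathbf{a}$ is the minimum total degree of the monomials appearing in the expansion of $f(x_1+a_1,\ldots,x_n+a_n)$ (it is $\infty$ for $f=0$). "$f$ has a zero of multiplicity at least $k$ at $\mathbf{a}$" means this multiplicity is $\ge k$, and "a zero of multiplicity exactly $l$" means it equals $l$ (with $l=0$ meaning $f(\mathbf{a})\ne0$). -}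

module Defs where

open import Level using (Level; _⊔_) renaming (suc to lsuc)
open import Algebra.Bundles using (CommutativeRing)
open import Data.Nat as ℕ using (ℕ; zero; suc; _∸_)
open import Data.Nat.Combinatorics using (_C_)
open import Data.Vec as Vec using (Vec; []; _∷_)
open import Data.Vec.Relation.Unary.All using (All)
open import Data.List as List using (List; []; _∷_)
open import Data.Sum using (_⊎_)
open import Data.Product using (Σ; ∃; ∃-syntax; _×_; _,_)
open import Relation.Nullary using (¬_)
open import Relation.Binary.PropositionalEquality using (_≡_; _≢_)

-- The real numbers, axiomatised as a (Dedekind-)complete ordered field.
-- (agda-stdlib has no ℝ; the statement is quantified over every model of
-- these axioms, all of which are isomorphic to ℝ.)

record RealField (c ℓ : Level) : Set (lsuc (c ⊔ ℓ)) where
  field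
    commutativeRing : CommutativeRing c ℓ
  open CommutativeRing commutativeRing public
  infix 4 _<ᵣ_ _≤ᵣ_
  field
    _<ᵣ_        : Carrier → Carrier → Set ℓ
    <-resp-≈    : ∀ {x x′ y y′} → x ≈ x′ → y ≈ y′ → x <ᵣ y → x′ <ᵣ y′
    <-irrefl    : ∀ {x} → ¬ (x <ᵣ x)
    <-trans     : ∀ {x y z} → x <ᵣ y → y <ᵣ z → x <ᵣ z
    <-trichot   : ∀ x y → (x <ᵣ y) ⊎ ((x ≈ y) ⊎ (y <ᵣ x))
    +-mono-<    : ∀ {x y} z → x <ᵣ y → (x + z) <ᵣ (y + z)
    *-pos       : ∀ {x y} → 0# <ᵣ x → 0# <ᵣ y → 0# <ᵣ (x * y)
    0<1         : 0# <ᵣ 1#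
    inverse     : ∀ x → ¬ (x ≈ 0#) → ∃[ y ] (x * y ≈ 1#)
  _≤ᵣ_ : Carrier → Carrier → Set ℓ
  x ≤ᵣ y = (x <ᵣ y) ⊎ (x ≈ y)
  field
    completeness : (S : Carrier → Set ℓ) → ∃[ x ] S x →
                   ∃[ b ] (∀ x → S x → x ≤ᵣ b) →
                   ∃[ s ] ((∀ x → S x → x ≤ᵣ s) ×
                           (∀ b → (∀ x → S x → x ≤ᵣ b) → s ≤ᵣ b))

∣_∣ : ∀ {n} → Vec ℕ n → ℕ
∣ α ∣ = Vec.sum α

box : ℕ → (n : ℕ) → List (Vec ℕ n)
box D zero    = [] ∷ []
box D (suc n) = List.concatMap (λ i → List.map (i ∷_) (box D n)) (List.upTo (suc D))

module WithReals {c ℓ} (ℝ : RealField c ℓ) where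
  open RealField ℝ

  ι : ℕ → Carrier
  ι zero    = 0#
  ι (suc k) = 1# + ι k

  _^ᵣ_ : Carrier → ℕ → Carrier
  x ^ᵣ zero  = 1#
  x ^ᵣ suc k = x * (x ^ᵣ k)

  sumL : List Carrier → Carrier
  sumL = List.foldr _+_ 0#

  prodV : ∀ {n} → Vec Carrier n → Carrier
  prodV = Vec.foldr _ _*_ 1#

  record Poly (n : ℕ) : Set (c ⊔ ℓ) where
    field
      coef   : Vec ℕ n → Carrier
      bound  : ℕ
      finite : ∀ α → bound ℕ.< ∣ α ∣ → coef α ≈ 0#
  open Poly public

  -- Coefficient of x^β in the expansion of P(x₁+a₁,…,xₙ+aₙ)
  -- (binomial expansion: Σ_α coef α · Π_i C(α_i,β_i) a_i^(α_i-β_i)).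
  shiftCoef : ∀ {n} → Poly n → Vec Carrier n → Vec ℕ n → Carrier
  shiftCoef {n} P a β =
    sumL (List.map (λ α → coef P α *
            prodV (Vec.zipWith _*_
                     (Vec.zipWith (λ αᵢ βᵢ → ι (αᵢ C βᵢ)) α β)
                     (Vec.zipWith (λ aᵢ e → aᵢ ^ᵣ e) a
                        (Vec.zipWith _∸_ α β))))
         (box (bound P) n))

  MultAtLeast : ∀ {n} → Poly n → Vec Carrier n → ℕ → Set ℓ
  MultAtLeast P a k = ∀ β → ∣ β ∣ ℕ.< k → shiftCoef P a β ≈ 0#

  MultExactly : ∀ {n} → Poly n → Vec Carrier n → ℕ → Set ℓ
  MultExactly P a l =
    MultAtLeast P a l × ∃[ β ] (∣ β ∣ ≡ l × ¬ (shiftCoef P a β ≈ 0#))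

  DegAtLeast : ∀ {n} → Poly n → ℕ → Set ℓ
  DegAtLeast P d = ∃[ α ] (d ℕ.≤ ∣ α ∣ × ¬ (coef P α ≈ 0#))

  DegEq : ∀ {n} → Poly n → ℕ → Set ℓ
  DegEq P d = DegAtLeast P d × (∀ α → d ℕ.< ∣ α ∣ → coef P α ≈ 0#)

  Admissible : ℕ → (n : ℕ) → ℕ → ℕ → Poly n → Set ℓ
  Admissible m n k l P =
    (∀ (a : Vec ℕ n) → All (ℕ._≤ m) a → a ≢ Vec.replicate n 0 →
       MultAtLeast P (Vec.map ι a) k)
    × MultExactly P (Vec.replicate n 0#) l

{-# OPTIONS --safe #-}
-- Lower bounds.  Let φ be the divided difference functional of the points 0, 1, …, m, with 0
-- taken q + 1 times and the others p times each.  It kills all polynomials of degree < q + mp,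
-- and on a polynomial vanishing to order p at 1, …, m it reads off the coefficient of x^q of
-- J · ∏ₐ (1 − x/a)^(−p), where J is the Taylor series at 0.  Apply a tensor product of such
-- functionals, with parameters (qᵢ , pᵢ), to P.  In case (i), take q = β with |β| = k − 1 and
-- p = q + 1: the value is the Taylor coefficient of P at 0 with index β.  In case (ii), take
-- |q| = k − 2 and p = q + 1 except for one coordinate where p = q + 2.  If deg P were too small,
-- all these values would vanish, and comparing the choices of the exceptional coordinate gives
-- linear relations between the Taylor coefficients at 0 which force the lowest ones to vanish.
--
-- Sharpness.  With g = x(x − 1)⋯(x − m) choose h_0 = (x − 1)⋯(x − m) and h_1, h_2, … of degree
-- < m such that h_0 + h_1 g + ⋯ + h_q g^q vanishes to order q + 1 at 1, …, m.  The polynomial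
-- g(x₁)^l · Σ ∏ᵢ g(xᵢ)^γᵢ h_γᵢ(xᵢ), summed over |γ| < k − l, has the same Taylor coefficients of
-- order < k at the points of the grid as the corresponding product of univariate sums.
module Submission where

open import Defs
open import Level using (_⊔_)
import Algebra.Properties.Ring as RingProperties
import Algebra.Solver.Ring as RingSolver
open import Algebra.Solver.Ring.AlmostCommutativeRing using (fromCommutativeRing; _-Raw-AlmostCommutative⟶_)
open import Data.Bool using (if_then_else_)
open import Data.Empty using (⊥-elim)
open import Data.Integer as ℤ using (ℤ; +_; -[1+_])
import Data.Integer.Properties as ℤₚ
open import Data.List as List using (List; []; _∷_)
import Data.Maybe as Maybe
open import Data.Nat as ℕ using (ℕ; zero; suc; _∸_; s≤s; z≤n)
open import Data.Nat.Combinatorics using (_C_; nCk+nC[k+1]≡[n+1]C[k+1]; k>n⇒nCk≡0; nCn≡1; nCk≡nC[n∸k])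
import Data.Nat.Properties as ℕₚ
open import Data.Nat.Tactic.RingSolver using (solve-∀)
open import Data.Product using (∃-syntax; _×_; _,_; proj₁; proj₂)
import Data.Sign as Sign
open import Data.Sum using (_⊎_; inj₁; inj₂)
open import Data.Vec as Vec using (Vec; []; _∷_)
import Data.Vec.Properties as Vecₚ
open import Data.Vec.Relation.Unary.All using (All; []; _∷_)
open import Data.Vec.Relation.Binary.Pointwise.Inductive using (Pointwise; []; _∷_)
open import Function using (_∘_; id; case_of_)
open import Relation.Binary.PropositionalEquality as ≡ using (_≡_; _≢_)
open import Relation.Nullary using (¬_; Dec; yes; no)
open import Relation.Binary.Definitions using (tri<; tri≈; tri>)
open import Relation.Nullary.Decidable using (dec⇒maybe)

module Proof {c ℓ} (ℝ : RealField c ℓ) where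

  open RealField ℝ hiding (zero)
  open WithReals ℝ
  open RingProperties ring using (-‿distribˡ-*; -‿distribʳ-*; -‿involutive; -0#≈0#; -‿+-comm)
  open import Relation.Binary.Reasoning.Setoid setoid

  infix 4 _≉0
  _≉0 : Carrier → Set ℓ
  x ≉0 = ¬ (x ≈ 0#)

  -- The integers inside the field, as coefficients for the ring solver.

  ι-+ : ∀ m n → ι (m ℕ.+ n) ≈ ι m + ι n
  ι-+ zero    n = sym (+-identityˡ _)
  ι-+ (suc m) n = trans (+-congˡ (ι-+ m n)) (sym (+-assoc _ _ _))

  ι-* : ∀ m n → ι (m ℕ.* n) ≈ ι m * ι n
  ι-* zero    n = sym (zeroˡ _)
  ι-* (suc m) n = begin
    ι (n ℕ.+ m ℕ.* n)    ≈⟨ ι-+ n (m ℕ.* n) ⟩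
    ι n + ι (m ℕ.* n)    ≈⟨ +-cong (sym (*-identityˡ _)) (ι-* m n) ⟩
    1# * ι n + ι m * ι n ≈⟨ distribʳ _ _ _ ⟨
    (1# + ι m) * ι n     ∎

  -- Integer coefficients have decidable equality, so the solver can collect them; numerals in
  -- solver terms then denote their images under `ι`.
  ιℤ : ℤ → Carrier
  ιℤ (+ n)      = ι n
  ιℤ (-[1+ n ]) = - ι (suc n)

  ιℤ-⊖ : ∀ m n → ιℤ (m ℤ.⊖ n) ≈ ι m + - ι n
  ιℤ-⊖ m       zero    = sym (trans (+-congˡ -0#≈0#) (+-identityʳ _))
  ιℤ-⊖ zero    (suc n) = sym (+-identityˡ _)
  ιℤ-⊖ (suc m) (suc n) = begin
    ιℤ (suc m ℤ.⊖ suc n)        ≡⟨ ≡.cong ιℤ (ℤₚ.[1+m]⊖[1+n]≡m⊖n m n) ⟩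
    ιℤ (m ℤ.⊖ n)                ≈⟨ ιℤ-⊖ m n ⟩
    ι m + - ι n                 ≈⟨ +-congʳ (+-identityˡ _) ⟨
    0# + ι m + - ι n            ≈⟨ +-congʳ (+-congʳ (-‿inverseʳ 1#)) ⟨
    1# + - 1# + ι m + - ι n     ≈⟨ +-congʳ (+-assoc _ _ _) ⟩
    1# + (- 1# + ι m) + - ι n   ≈⟨ +-congʳ (+-congˡ (+-comm _ _)) ⟩
    1# + (ι m + - 1#) + - ι n   ≈⟨ +-congʳ (+-assoc _ _ _) ⟨
    1# + ι m + - 1# + - ι n     ≈⟨ +-assoc _ _ _ ⟩
    1# + ι m + (- 1# + - ι n)   ≈⟨ +-congˡ (-‿+-comm _ _) ⟩
    1# + ι m + - (1# + ι n)     ∎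

  ιℤ-+ : ∀ i j → ιℤ (i ℤ.+ j) ≈ ιℤ i + ιℤ j
  ιℤ-+ (+ m)    (+ n)    = ι-+ m n
  ιℤ-+ (+ m)    -[1+ n ] = ιℤ-⊖ m (suc n)
  ιℤ-+ -[1+ m ] (+ n)    = trans (ιℤ-⊖ n (suc m)) (+-comm _ _)
  ιℤ-+ -[1+ m ] -[1+ n ] = begin
    - ι (suc (suc (m ℕ.+ n)))     ≡⟨ ≡.cong (λ z → - ι z) (≡.sym (ℕₚ.+-suc (suc m) n)) ⟩
    - ι (suc m ℕ.+ suc n)         ≈⟨ -‿cong (ι-+ (suc m) (suc n)) ⟩
    - (ι (suc m) + ι (suc n))     ≈⟨ -‿+-comm _ _ ⟨
    - ι (suc m) + - ι (suc n)     ∎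

  ιℤ-neg : ∀ i → ιℤ (ℤ.- i) ≈ - ιℤ i
  ιℤ-neg (+ zero)    = sym -0#≈0#
  ιℤ-neg (+ (suc n)) = refl
  ιℤ-neg -[1+ n ]    = sym (-‿involutive _)

  ιℤ--◃ : ∀ n → ιℤ (Sign.- ℤ.◃ n) ≈ - ι n
  ιℤ--◃ zero    = sym -0#≈0#
  ιℤ--◃ (suc n) = refl

  ιℤ-+◃ : ∀ n → ιℤ (Sign.+ ℤ.◃ n) ≈ ι n
  ιℤ-+◃ zero    = refl
  ιℤ-+◃ (suc n) = refl

  ιℤ-* : ∀ i j → ιℤ (i ℤ.* j) ≈ ιℤ i * ιℤ j
  ιℤ-* (+ m)    (+ n)    = trans (ιℤ-+◃ (m ℕ.* n)) (ι-* m n)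
  ιℤ-* (+ m)    -[1+ n ] = trans (ιℤ--◃ (m ℕ.* suc n)) (trans (-‿cong (ι-* m (suc n))) (-‿distribʳ-* _ _))
  ιℤ-* -[1+ m ] (+ n)    = trans (ιℤ--◃ (suc m ℕ.* n)) (trans (-‿cong (ι-* (suc m) n)) (-‿distribˡ-* _ _))
  ιℤ-* -[1+ m ] -[1+ n ] = begin
    ι (suc m ℕ.* suc n)            ≈⟨ ι-* (suc m) (suc n) ⟩
    ι (suc m) * ι (suc n)          ≈⟨ -‿involutive _ ⟨
    - - (ι (suc m) * ι (suc n))    ≈⟨ -‿cong (-‿distribˡ-* _ _) ⟩
    - (- ι (suc m) * ι (suc n))    ≈⟨ -‿distribʳ-* _ _ ⟩
    - ι (suc m) * - ι (suc n)      ∎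

  ιℤ-morphism : ℤ.+-*-rawRing -Raw-AlmostCommutative⟶ fromCommutativeRing commutativeRing
  ιℤ-morphism = record
    { ⟦_⟧    = ιℤ
    ; +-homo = ιℤ-+
    ; *-homo = ιℤ-*
    ; -‿homo = ιℤ-neg
    ; 0-homo = refl
    ; 1-homo = +-identityʳ _
    }

  open RingSolver ℤ.+-*-rawRing (fromCommutativeRing commutativeRing) ιℤ-morphism
         (λ i j → Maybe.map (reflexive ∘ ≡.cong ιℤ) (dec⇒maybe (i ℤ.≟ j)))
       using (solve; _:=_; _:+_; _:*_; :-_; con)

  -- Order and nonvanishing in the field.

  ≈⇒≮ : ∀ {x y} → x ≈ y → ¬ (x <ᵣ y)
  ≈⇒≮ x≈y x<y = <-irrefl (<-resp-≈ x≈y refl x<y)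

  infix 4 _≈?_
  -- Trichotomy decides equality; the case distinctions on whether a value vanishes rest on this.
  _≈?_ : ∀ x y → Dec (x ≈ y)
  x ≈? y with <-trichot x y
  ... | inj₁ x<y        = no λ x≈y → ≈⇒≮ x≈y x<y
  ... | inj₂ (inj₁ x≈y) = yes x≈y
  ... | inj₂ (inj₂ y<x) = no λ x≈y → ≈⇒≮ (sym x≈y) y<x

  pos⇒≉0 : ∀ {x} → 0# <ᵣ x → x ≉0
  pos⇒≉0 0<x x≈0 = ≈⇒≮ (sym x≈0) 0<x

  +-pos-pos : ∀ {x y} → 0# <ᵣ x → 0# <ᵣ y → 0# <ᵣ x + y
  +-pos-pos {x} {y} 0<x 0<y = <-trans 0<y (<-resp-≈ (+-identityˡ y) refl (+-mono-< y 0<x))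

  +-pos-nonneg : ∀ {x y} → 0# <ᵣ x → 0# ≤ᵣ y → 0# <ᵣ x + y
  +-pos-nonneg 0<x (inj₁ 0<y) = +-pos-pos 0<x 0<y
  +-pos-nonneg 0<x (inj₂ 0≈y) = <-resp-≈ refl (trans (sym (+-identityʳ _)) (+-congˡ 0≈y)) 0<x

  ι-pos : ∀ n → 0# <ᵣ ι (suc n)
  ι-pos zero    = <-resp-≈ refl (sym (+-identityʳ 1#)) 0<1
  ι-pos (suc n) = +-pos-pos 0<1 (ι-pos n)

  1≉0 : 1# ≉0
  1≉0 = pos⇒≉0 0<1

  x*y≈0⇒y≈0 : ∀ {x y} → x ≉0 → x * y ≈ 0# → y ≈ 0#
  x*y≈0⇒y≈0 {x} {y} x≉0 xy≈0 with inverse x x≉0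
  ... | (x⁻¹ , xx⁻¹≈1) = begin
    y              ≈⟨ *-identityˡ y ⟨
    1# * y         ≈⟨ *-congʳ xx⁻¹≈1 ⟨
    x * x⁻¹ * y    ≈⟨ solve 3 (λ a b c → a :* b :* c := b :* (a :* c)) refl x x⁻¹ y ⟩
    x⁻¹ * (x * y)  ≈⟨ *-congˡ xy≈0 ⟩
    x⁻¹ * 0#       ≈⟨ zeroʳ _ ⟩
    0#             ∎

  *-≉0 : ∀ {x y} → x ≉0 → y ≉0 → x * y ≉0
  *-≉0 x≉0 y≉0 xy≈0 = y≉0 (x*y≈0⇒y≈0 x≉0 xy≈0)

  *-≉0ˡ : ∀ {x y} → x * y ≉0 → x ≉0
  *-≉0ˡ xy≉0 x≈0 = xy≉0 (trans (*-congʳ x≈0) (zeroˡ _))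

  *-≉0ʳ : ∀ {x y} → x * y ≉0 → y ≉0
  *-≉0ʳ xy≉0 y≈0 = xy≉0 (trans (*-congˡ y≈0) (zeroʳ _))

  *-0ˡ : ∀ {x y} → x ≈ 0# → x * y ≈ 0#
  *-0ˡ x≈0 = trans (*-congʳ x≈0) (zeroˡ _)

  *-0ʳ : ∀ {x y} → y ≈ 0# → x * y ≈ 0#
  *-0ʳ y≈0 = trans (*-congˡ y≈0) (zeroʳ _)

  +-0 : ∀ {x y} → x ≈ 0# → y ≈ 0# → x + y ≈ 0#
  +-0 x≈0 y≈0 = trans (+-cong x≈0 y≈0) (+-identityʳ _)

  -- Characteristic zero: up to sign the difference is `ι (suc d)`, which is positive.
  ι-diff-≉0 : ∀ {a b} → a ≢ b → ι b + - ι a ≉0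
  ι-diff-≉0 {a} {b} a≢b with ℕₚ.<-cmp a b
  ... | tri< a<b _ _ = λ eq → pos⇒≉0 (ι-pos d) (begin
      ι (suc d)                ≈⟨ solve 2 (λ u v → u := (v :+ u) :+ :- v) refl (ι (suc d)) (ι a) ⟩
      (ι a + ι (suc d)) + - ι a ≈⟨ +-congʳ (ι-+ a (suc d)) ⟨
      ι (a ℕ.+ suc d) + - ι a  ≡⟨ ≡.cong (λ z → ι z + - ι a) a+1+d≡b ⟩
      ι b + - ι a              ≈⟨ eq ⟩
      0#                       ∎)
    where
    d = b ∸ suc a
    a+1+d≡b = ≡.trans (ℕₚ.+-suc a d) (ℕₚ.m+[n∸m]≡n a<b)
  ... | tri≈ _ a≡b _ = ⊥-elim (a≢b a≡b)
  ... | tri> _ _ b<a = λ eq → pos⇒≉0 (ι-pos d) (begin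
      ι (suc d)                    ≈⟨ solve 2 (λ u v → u := :- (v :+ :- (v :+ u))) refl (ι (suc d)) (ι b) ⟩
      - (ι b + - (ι b + ι (suc d))) ≈⟨ -‿cong (+-congˡ (-‿cong (ι-+ b (suc d)))) ⟨
      - (ι b + - ι (b ℕ.+ suc d))  ≡⟨ ≡.cong (λ z → - (ι b + - ι z)) b+1+d≡a ⟩
      - (ι b + - ι a)              ≈⟨ -‿cong eq ⟩
      - 0#                         ≈⟨ -0#≈0# ⟩
      0#                           ∎)
    where
    d = a ∸ suc b
    b+1+d≡a = ≡.trans (ℕₚ.+-suc b d) (ℕₚ.m+[n∸m]≡n b<a)

  -- Linear functionals on univariate polynomials

  Seq : Set c
  Seq = ℕ → Carrier

  infix  4 _≐_
  infixl 6 _⊕_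
  infixl 7 _⊙_

  _≐_ : Seq → Seq → Set ℓ
  φ ≐ ψ = ∀ e → φ e ≈ ψ e

  _⊕_ : Seq → Seq → Seq
  (φ ⊕ ψ) e = φ e + ψ e

  _⊙_ : Carrier → Seq → Seq
  (k ⊙ φ) e = k * φ e

  𝟘 : Seq
  𝟘 _ = 0#

  -- D a j is the functional p ↦ p⁽ʲ⁾(a)/j!, given by its values on the
  -- monomials xᵉ; sequences stand for linear functionals in this way throughout.
  D : Carrier → ℕ → Seq
  D a j e = ι (e C j) * (a ^ᵣ (e ∸ j))

  nC0≡1 : ∀ n → n C 0 ≡ 1
  nC0≡1 n = ≡.trans (nCk≡nC[n∸k] {0} {n} z≤n) (nCn≡1 n)

  D-0-0 : ∀ a → D a 0 0 ≈ 1#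
  D-0-0 a = trans (*-identityʳ _) (+-identityʳ _)

  D-suc-0 : ∀ a j → D a (suc j) 0 ≈ 0#
  D-suc-0 a j = trans (*-congʳ (reflexive (≡.cong ι (k>n⇒nCk≡0 {0} {suc j} (s≤s z≤n))))) (zeroˡ _)

  D-0-suc : ∀ a e → D a 0 (suc e) ≈ a * D a 0 e
  D-0-suc a e = begin
    ι (suc e C 0) * (a * a ^ᵣ e)  ≡⟨ ≡.cong (λ z → ι z * (a * a ^ᵣ e)) (≡.trans (nC0≡1 (suc e)) (≡.sym (nC0≡1 e))) ⟩
    ι (e C 0) * (a * a ^ᵣ e)      ≈⟨ solve 3 (λ u v w → u :* (v :* w) := v :* (u :* w)) refl _ _ _ ⟩
    a * (ι (e C 0) * a ^ᵣ e)      ∎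

  -- Pascal's rule; in terms of functionals, the Leibniz rule for x · p with x = a + (x - a).
  D-suc-suc : ∀ a j e → D a (suc j) (suc e) ≈ a * D a (suc j) e + D a j e
  D-suc-suc a j e = begin
    ι (suc e C suc j) * A                  ≡⟨ ≡.cong (λ z → ι z * A) (≡.sym (nCk+nC[k+1]≡[n+1]C[k+1] e j)) ⟩
    ι (e C j ℕ.+ e C suc j) * A            ≈⟨ *-congʳ (ι-+ (e C j) (e C suc j)) ⟩
    (ι (e C j) + ι (e C suc j)) * A        ≈⟨ solve 3 (λ u v w → (u :+ v) :* w := v :* w :+ u :* w) refl _ _ _ ⟩
    ι (e C suc j) * A + ι (e C j) * A      ≈⟨ +-congʳ lower ⟩
    a * (ι (e C suc j) * a ^ᵣ (e ∸ suc j)) + ι (e C j) * A ∎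
    where
    A = a ^ᵣ (e ∸ j)
    lower : ι (e C suc j) * A ≈ a * (ι (e C suc j) * a ^ᵣ (e ∸ suc j))
    lower with suc j ℕ.≤? e
    ... | yes j<e = begin
      ι (e C suc j) * a ^ᵣ (e ∸ j)              ≡⟨ ≡.cong (λ z → ι (e C suc j) * a ^ᵣ z) (ℕₚ.+-∸-assoc 1 j<e) ⟩
      ι (e C suc j) * (a * a ^ᵣ (e ∸ suc j))    ≈⟨ solve 3 (λ u v w → u :* (v :* w) := v :* (u :* w)) refl _ _ _ ⟩
      a * (ι (e C suc j) * a ^ᵣ (e ∸ suc j))    ∎
    -- For e ≤ j the binomial coefficient vanishes, so the truncated exponents are harmless.
    ... | no j≮e = trans (*-0ˡ C≈0) (sym (*-0ʳ (*-0ˡ C≈0)))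
      where
      C≈0 : ι (e C suc j) ≈ 0#
      C≈0 = reflexive (≡.cong ι (k>n⇒nCk≡0 (ℕₚ.≰⇒> j≮e)))

  -- The functional p ↦ φ(−a · (p − p(a))/(x − a)); on functionals at 0 it is
  -- multiplication by the power series 1/(1 − x/a).
  U : Carrier → Seq → Seq
  U a φ zero    = 0#
  U a φ (suc e) = a * (U a φ e + - φ e)

  -- The recursion determines `U a φ`, so each identity below reduces to checking that its other
  -- side starts at 0 and obeys the recursion.
  U-unique : ∀ a {φ ψ} → ψ 0 ≈ 0# → (∀ e → ψ (suc e) ≈ a * (ψ e + - φ e)) → U a φ ≐ ψ
  U-unique a ψ0 ψs zero    = sym ψ0
  U-unique a ψ0 ψs (suc e) = trans (*-congˡ (+-congʳ (U-unique a ψ0 ψs e))) (sym (ψs e))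

  U-cong : ∀ a {φ ψ} → φ ≐ ψ → U a φ ≐ U a ψ
  U-cong a φ≐ψ = U-unique a refl (λ e → *-congˡ (+-congˡ (-‿cong (sym (φ≐ψ e)))))

  U-𝟘 : ∀ a → U a 𝟘 ≐ 𝟘
  U-𝟘 a = U-unique a refl (λ e → sym (*-0ʳ (-‿inverseʳ 0#)))

  U-⊕ : ∀ a φ ψ → U a (φ ⊕ ψ) ≐ U a φ ⊕ U a ψ
  U-⊕ a φ ψ = U-unique a (+-identityʳ _) (λ e →
    solve 5 (λ a u v x y → a :* (u :+ :- x) :+ a :* (v :+ :- y) := a :* ((u :+ v) :+ :- (x :+ y)))
      refl a (U a φ e) (U a ψ e) (φ e) (ψ e))

  U-⊙ : ∀ a k φ → U a (k ⊙ φ) ≐ k ⊙ U a φ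
  U-⊙ a k φ = U-unique a (zeroʳ _) (λ e →
    solve 4 (λ a k u x → k :* (a :* (u :+ :- x)) := a :* (k :* u :+ :- (k :* x)))
      refl a k (U a φ e) (φ e))

  -- Dividing by x - a lowers the degree by one, so one further monomial is killed.
  U-vanish : ∀ a {φ} N → (∀ e → e ℕ.< N → φ e ≈ 0#) → ∀ e → e ℕ.< suc N → U a φ e ≈ 0#
  U-vanish a N φ≈0 zero    _       = refl
  U-vanish a N φ≈0 (suc e) (s≤s e<N) =
    *-0ʳ (+-0 (U-vanish a N φ≈0 e (ℕₚ.m≤n⇒m≤1+n e<N)) (trans (-‿cong (φ≈0 e e<N)) -0#≈0#))

  -- Coefficient j at a of the quotient (p - p(a))/(x - a) is coefficient j + 1 of p: the order at a
  -- rises by one.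
  U-D-same : ∀ a j → U a (D a j) ≐ (- a) ⊙ D a (suc j)
  U-D-same a j = U-unique a (*-0ʳ (D-suc-0 a j)) (λ e → trans (*-congˡ (D-suc-suc a j e))
    (solve 3 (λ a x y → :- a :* (a :* x :+ y) := a :* (:- a :* x :+ :- y)) refl a (D a (suc j) e) (D a j e)))

  module _ {a b i} (inv : (b + - a) * i ≈ 1#) where

    -- The quotient takes the value (p(b) - p(a))/(b - a) at b, with `i` = 1/(b - a).
    U-D-zero : U a (D b 0) ≐ (- a * i) ⊙ (D b 0 ⊕ (- 1#) ⊙ D a 0)
    U-D-zero = U-unique a
      (*-0ʳ (trans (+-cong (D-0-0 b) (*-congˡ (D-0-0 a))) (trans (+-congˡ (*-identityʳ _)) (-‿inverseʳ 1#))))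
      (λ e → let B = D b 0 e ; A = D a 0 e in begin
        (- a * i) * (D b 0 (suc e) + - 1# * D a 0 (suc e))
          ≈⟨ *-congˡ (+-cong (D-0-suc b e) (*-congˡ (D-0-suc a e))) ⟩
        (- a * i) * (b * B + - 1# * (a * A))
          ≈⟨ solve 6 (λ a b i A B n → (:- a :* i) :* (b :* B :+ n :* (a :* A))
                := a :* ((:- a :* i) :* (B :+ n :* A) :+ :- (((b :+ :- a) :* i) :* B))) refl a b i A B (- 1#) ⟩
        a * ((- a * i) * (B + - 1# * A) + - (((b + - a) * i) * B))
          ≈⟨ *-congˡ (+-congˡ (-‿cong (trans (*-congʳ inv) (*-identityˡ _)))) ⟩
        a * ((- a * i) * (B + - 1# * A) + - B) ∎)

    -- Compare the coefficients of order j + 1 at b in (x - a) r = p - p(a): (b - a) r_(j+1) + r_j =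
    -- p_(j+1).
    U-D-suc : ∀ j → U a (D b (suc j)) ≐ i ⊙ ((- a) ⊙ D b (suc j) ⊕ (- 1#) ⊙ U a (D b j))
    U-D-suc j = U-unique a
      (*-0ʳ (+-0 (*-0ʳ (D-suc-0 b j)) (zeroʳ _)))
      (λ e → let X = D b (suc j) e ; Y = D b j e ; V = U a (D b j) e in begin
        i * (- a * D b (suc j) (suc e) + - 1# * (a * (V + - Y)))
          ≈⟨ *-congˡ (+-cong (*-congˡ (D-suc-suc b j e)) (trans (sym (-‿distribˡ-* _ _)) (-‿cong (*-identityˡ _)))) ⟩
        i * (- a * (b * X + Y) + - (a * (V + - Y)))
          ≈⟨ solve 6 (λ a b i X Y V → i :* (:- a :* (b :* X :+ Y) :+ :- (a :* (V :+ :- Y)))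
                := a :* (i :* (:- a :* X :+ :- V) :+ :- (((b :+ :- a) :* i) :* X))) refl a b i X Y V ⟩
        a * (i * (- a * X + - V) + - (((b + - a) * i) * X))
          ≈⟨ *-congˡ (+-cong (*-congˡ (+-congˡ (trans (-‿cong (sym (*-identityˡ V))) (-‿distribˡ-* _ _))))
                             (-‿cong (trans (*-congʳ inv) (*-identityˡ _)))) ⟩
        a * (i * (- a * X + - 1# * V) + - X) ∎)

  module _ {a r} (a*r≈1 : a * r ≈ 1#) where

    private
      inv : (0# + - a) * - r ≈ 1#
      inv = trans (solve 2 (λ a r → (con (+ 0) :+ :- a) :* :- r := a :* r) refl a r) a*r≈1

      -a*-r≈1 : - a * - r ≈ 1#
      -a*-r≈1 = trans (solve 2 (λ a r → :- a :* :- r := a :* r) refl a r) a*r≈1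

    U-D0-zero : U a (D 0# 0) ≐ D 0# 0 ⊕ (- 1#) ⊙ D a 0
    U-D0-zero e = trans (U-D-zero inv e) (trans (*-congʳ -a*-r≈1) (*-identityˡ _))

    -- Reflects 1/(1 - x/a) = 1 + (x/a) · 1/(1 - x/a), with `r` = 1/a.
    U-D0-suc : ∀ j → U a (D 0# (suc j)) ≐ D 0# (suc j) ⊕ r ⊙ U a (D 0# j)
    U-D0-suc j e = trans (U-D-suc inv j e) (begin
      - r * (- a * X + - 1# * V)
        ≈⟨ solve 4 (λ a r X V → :- r :* (:- a :* X :+ V) := (a :* r) :* X :+ r :* :- V) refl a r X (- 1# * V) ⟩
      (a * r) * X + r * - (- 1# * V)
        ≈⟨ +-cong (trans (*-congʳ a*r≈1) (*-identityˡ _))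
                  (*-congˡ (trans (-‿distribˡ-* _ _) (trans (*-congʳ (-‿involutive 1#)) (*-identityˡ _)))) ⟩
      X + r * V ∎)
      where
      X = D 0# (suc j) e
      V = U a (D 0# j) e

  -- Spans of point functionals and congruence modulo such spans.

  data Span (A : ℕ → ℕ → Set) : Seq → Set (c ⊔ ℓ) where
    gen  : ∀ {b j} → A b j → Span A (D (ι b) j)
    zer  : Span A 𝟘
    add  : ∀ {φ ψ} → Span A φ → Span A ψ → Span A (φ ⊕ ψ)
    scl  : ∀ {φ} k → Span A φ → Span A (k ⊙ φ)
    resp : ∀ {φ ψ} → φ ≐ ψ → Span A φ → Span A ψ

  Span-map : ∀ {A B : ℕ → ℕ → Set} → (∀ {b j} → A b j → B b j) → ∀ {φ} → Span A φ → Span B φ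
  Span-map f (gen x)    = gen (f x)
  Span-map f zer        = zer
  Span-map f (add s t)  = add (Span-map f s) (Span-map f t)
  Span-map f (scl k s)  = scl k (Span-map f s)
  Span-map f (resp e s) = resp e (Span-map f s)

  record Split (B : ℕ → ℕ → Set) (φ z : Seq) : Set (c ⊔ ℓ) where
    constructor split
    field
      {rest}   : Seq
      rest-in  : Span B rest
      φ≐z⊕rest : φ ≐ z ⊕ rest

  Split-refl : ∀ {B φ} → Split B φ φ
  Split-refl = split zer (λ e → sym (+-identityʳ _))

  Split-resp : ∀ {B φ φ′ z z′} → φ ≐ φ′ → z ≐ z′ → Split B φ z → Split B φ′ z′
  Split-resp φ≐φ′ z≐z′ (split s eq) = split s (λ e → trans (sym (φ≐φ′ e)) (trans (eq e) (+-congʳ (z≐z′ e))))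

  Split-⊕ : ∀ {B φ φ′ z z′} → Split B φ z → Split B φ′ z′ → Split B (φ ⊕ φ′) (z ⊕ z′)
  Split-⊕ (split s eq) (split s′ eq′) = split (add s s′) (λ e → trans (+-cong (eq e) (eq′ e))
    (solve 4 (λ a b c d → (a :+ b) :+ (c :+ d) := (a :+ c) :+ (b :+ d)) refl _ _ _ _))

  Split-⊙ : ∀ {B φ z} k → Split B φ z → Split B (k ⊙ φ) (k ⊙ z)
  Split-⊙ k (split s eq) = split (scl k s) (λ e → trans (*-congˡ (eq e)) (distribˡ _ _ _))

  Split-map : ∀ {A B : ℕ → ℕ → Set} {φ z} → (∀ {b j} → A b j → B b j) → Split A φ z → Split B φ z
  Split-map f (split s eq) = split (Span-map f s) eq

  Split-trans : ∀ {B φ ψ z} → Split B φ ψ → Split B ψ z → Split B φ z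
  Split-trans (split s eq) (split s′ eq′) = split (add s′ s) (λ e → trans (eq e) (trans (+-congʳ (eq′ e)) (+-assoc _ _ _)))

  Low : ℕ → ℕ → ℕ → Set
  Low q b j = b ≡ 0 × j ℕ.< q

  -- Unit coefficient at order q, arbitrary ones below: a shape preserved by multiplication with a
  -- power series of constant term 1.
  Lead : ℕ → Seq → Set (c ⊔ ℓ)
  Lead q z = Split (Low q) z (D 0# q)

  -- Orders < p at the points 1..m, except that order p is allowed at 1..c.
  Grid : ℕ → ℕ → ℕ → ℕ → ℕ → Set
  Grid m p c b j = 1 ℕ.≤ b × b ℕ.≤ m × (j ℕ.< p ⊎ (j ℕ.≤ p × b ℕ.≤ c))

  NonZeroPts : ℕ → ℕ → ℕ → ℕ → Set
  NonZeroPts m p b j = 1 ℕ.≤ b × b ℕ.≤ m × j ℕ.< p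

  module _ {m p c : ℕ} (c<m : c ℕ.< m) where

    private
      a = ι (suc c)

      weaken : ∀ {b j} → Grid m p c b j → Grid m p (suc c) b j
      weaken (1≤b , b≤m , inj₁ j<p)         = 1≤b , b≤m , inj₁ j<p
      weaken (1≤b , b≤m , inj₂ (j≤p , b≤c)) = 1≤b , b≤m , inj₂ (j≤p , ℕₚ.m≤n⇒m≤1+n b≤c)

      lower : ∀ {b j} → Grid m p c b (suc j) → Grid m p c b j
      lower (1≤b , b≤m , inj₁ j<p)         = 1≤b , b≤m , inj₁ (ℕₚ.<-trans (ℕₚ.n<1+n _) j<p)
      lower (1≤b , b≤m , inj₂ (j≤p , b≤c)) = 1≤b , b≤m , inj₂ (ℕₚ.≤-trans (ℕₚ.n≤1+n _) j≤p , b≤c)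

    a∈Grid : Grid m p (suc c) (suc c) 0
    a∈Grid = s≤s z≤n , c<m , inj₂ (z≤n , ℕₚ.≤-refl)

    -- For b other than c + 1 the orders at b do not grow, and the only new term is a value at c +
    -- 1.
    U-gen-other : ∀ {b} → suc c ≢ b → ∀ j → Grid m p c b j → Span (Grid m p (suc c)) (U a (D (ι b) j))
    U-gen-other {b} a≢b j x with inverse _ (ι-diff-≉0 a≢b)
    U-gen-other {b} a≢b zero x | (i , inv) =
      resp (λ e → sym (U-D-zero inv e)) (scl _ (add (gen (weaken x)) (scl _ (gen a∈Grid))))
    U-gen-other {b} a≢b (suc j) x | (i , inv) =
      resp (λ e → sym (U-D-suc inv j e))
        (scl _ (add (scl _ (gen (weaken x))) (scl _ (U-gen-other a≢b j (lower x)))))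

    U-gen : ∀ {b j} → Grid m p c b j → Span (Grid m p (suc c)) (U a (D (ι b) j))
    U-gen {b} {j} x with suc c ℕ.≟ b
    U-gen {b} {j} x | no a≢b = U-gen-other a≢b j x
    U-gen {_} {j} (1≤b , b≤m , inj₁ j<p) | yes ≡.refl =
      resp (λ e → sym (U-D-same a j e)) (scl _ (gen (1≤b , b≤m , inj₂ (j<p , ℕₚ.≤-refl))))
    U-gen {_} {j} (1≤b , b≤m , inj₂ (_ , 1+c≤c)) | yes ≡.refl = ⊥-elim (ℕₚ.1+n≰n 1+c≤c)

    U-Span : ∀ {φ} → Span (Grid m p c) φ → Span (Grid m p (suc c)) (U a φ)
    U-Span (gen x)    = U-gen x
    U-Span zer        = resp (λ e → sym (U-𝟘 a e)) zer
    U-Span (add s t)  = resp (λ e → sym (U-⊕ a _ _ e)) (add (U-Span s) (U-Span t))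
    U-Span (scl k s)  = resp (λ e → sym (U-⊙ a k _ e)) (scl k (U-Span s))
    U-Span (resp e s) = resp (U-cong a e) (U-Span s)

  -- Passes over the points 1, ..., m.

  Round : ℕ → Seq → Seq
  Round zero    φ = φ
  Round (suc c) φ = U (ι (suc c)) (Round c φ)

  Round-cong : ∀ c {φ ψ} → φ ≐ ψ → Round c φ ≐ Round c ψ
  Round-cong zero    eq = eq
  Round-cong (suc c) eq = U-cong _ (Round-cong c eq)

  Round-⊕ : ∀ c φ ψ → Round c (φ ⊕ ψ) ≐ Round c φ ⊕ Round c ψ
  Round-⊕ zero    φ ψ e = refl
  Round-⊕ (suc c) φ ψ e = trans (U-cong _ (Round-⊕ c φ ψ) e) (U-⊕ _ _ _ e)

  Round-⊙ : ∀ c k φ → Round c (k ⊙ φ) ≐ k ⊙ Round c φ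
  Round-⊙ zero    k φ e = refl
  Round-⊙ (suc c) k φ e = trans (U-cong _ (Round-⊙ c k φ) e) (U-⊙ _ _ _ e)

  -- After c steps the points 1, ..., c have gained one order each; a full pass turns p into p + 1.
  Round-Span : ∀ {m p} c → c ℕ.≤ m → ∀ {φ} → Span (Grid m p 0) φ → Span (Grid m p c) (Round c φ)
  Round-Span zero    _   s = s
  Round-Span (suc c) c<m s = U-Span c<m (Round-Span c (ℕₚ.<⇒≤ c<m) s)

  Round-vanish : ∀ c {φ} N → (∀ e → e ℕ.< N → φ e ≈ 0#) → ∀ e → e ℕ.< N ℕ.+ c → Round c φ e ≈ 0#
  Round-vanish zero    N φ≈0 e e<N = φ≈0 e (≡.subst (e ℕ.<_) (ℕₚ.+-identityʳ N) e<N)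
  Round-vanish (suc c) N φ≈0 e e<N =
    U-vanish _ (N ℕ.+ c) (Round-vanish c N φ≈0) e (≡.subst (e ℕ.<_) (ℕₚ.+-suc N c) e<N)

  -- The error terms of a pass that starts at 0 are values at the points already visited, hence
  -- `p = 0` in `Grid`.
  Round-step : ∀ {m} c (c<m : c ℕ.< m) {φ z z′} →
    Split (Grid m 0 c) (Round c φ) z → Split (Grid m 0 (suc c)) (U (ι (suc c)) z) z′ →
    Split (Grid m 0 (suc c)) (Round (suc c) φ) z′
  Round-step c c<m (split s eq) t =
    Split-trans (split (U-Span c<m s) (λ e → trans (U-cong _ eq e) (U-⊕ _ _ _ e))) t

  ι⁻¹ : ∀ n → ∃[ r ] (ι (suc n) * r ≈ 1#)
  ι⁻¹ n = inverse _ (pos⇒≉0 (ι-pos n))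

  module _ {m c : ℕ} (c<m : c ℕ.< m) where

    private
      a = ι (suc c)
      r = proj₁ (ι⁻¹ c)
      a*r≈1 = proj₂ (ι⁻¹ c)

    U-split-0 : Split (Grid m 0 (suc c)) (U a (D 0# 0)) (D 0# 0)
    U-split-0 = split (scl _ (gen (a∈Grid c<m))) (U-D0-zero a*r≈1)

    U-split-suc : ∀ j {z} → Split (Grid m 0 (suc c)) (U a (D 0# j)) z →
      Split (Grid m 0 (suc c)) (U a (D 0# (suc j))) (D 0# (suc j) ⊕ r ⊙ z)
    U-split-suc j s = Split-resp (λ e → sym (U-D0-suc a*r≈1 j e)) (λ e → refl)
      (Split-⊕ Split-refl (Split-⊙ r s))

    -- The series 1/(1 - x/a) has constant term 1, so the top coefficient stays 1.
    U-split-lead : ∀ q → ∃[ z ] (Lead q z × Split (Grid m 0 (suc c)) (U a (D 0# q)) z)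
    U-split-lead zero    = D 0# 0 , Split-refl , U-split-0
    U-split-lead (suc q) with U-split-lead q
    ... | (z , split low eq , s) = _ ,
      split (scl r (resp (λ e → sym (eq e)) (add (gen (≡.refl , ℕₚ.n<1+n q)) (Span-map raise low)))) (λ e → refl) ,
      U-split-suc q s
      where
      raise : ∀ {b j} → Low q b j → Low (suc q) b j
      raise (b≡0 , j<q) = b≡0 , ℕₚ.m≤n⇒m≤1+n j<q

    U-split-Low : ∀ q {z} → Span (Low q) z → ∃[ z′ ] (Span (Low q) z′ × Split (Grid m 0 (suc c)) (U a z) z′)
    U-split-Low q (gen {j = j} (≡.refl , j<q)) with U-split-lead j
    ... | (z , split low eq , s) = z ,
      resp (λ e → sym (eq e)) (add (gen (≡.refl , j<q)) (Span-map (λ { (b≡0 , i<j) → b≡0 , ℕₚ.<-trans i<j j<q }) low)) , s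
    U-split-Low q zer = 𝟘 , zer , Split-resp (λ e → sym (U-𝟘 a e)) (λ _ → refl) Split-refl
    U-split-Low q (add s t) with U-split-Low q s | U-split-Low q t
    ... | (_ , u , s′) | (_ , v , t′) = _ , add u v ,
      Split-resp (λ e → sym (U-⊕ a _ _ e)) (λ _ → refl) (Split-⊕ s′ t′)
    U-split-Low q (scl k s) with U-split-Low q s
    ... | (_ , u , s′) = _ , scl k u , Split-resp (λ e → sym (U-⊙ a k _ e)) (λ _ → refl) (Split-⊙ k s′)
    U-split-Low q (resp eq s) with U-split-Low q s
    ... | (_ , u , s′) = _ , u , Split-resp (U-cong a eq) (λ _ → refl) s′

    U-split-Lead : ∀ q {z} → Lead q z → ∃[ z′ ] (Lead q z′ × Split (Grid m 0 (suc c)) (U a z) z′)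
    U-split-Lead q (split low eq) with U-split-lead q | U-split-Low q low
    ... | (_ , split l eq′ , s) | (_ , u , t) = _ ,
      split (add l u) (λ e → trans (+-congʳ (eq′ e)) (+-assoc _ _ _)) ,
      Split-resp (λ e → sym (trans (U-cong a eq e) (U-⊕ a _ _ e))) (λ _ → refl) (Split-⊕ s t)

  Round-Lead : ∀ {m} q c → c ℕ.≤ m → ∀ {z} → Lead q z → ∃[ z′ ] (Lead q z′ × Split (Grid m 0 c) (Round c z) z′)
  Round-Lead q zero    _   l = _ , l , Split-refl
  Round-Lead q (suc c) c<m l with Round-Lead q c (ℕₚ.<⇒≤ c<m) l
  ... | (_ , l′ , s) with U-split-Lead c<m q l′
  ... | (_ , l″ , t) = _ , l″ , Round-step c c<m s t

  -- ρ m and σ m are the coefficients of x and x² in ∏ₐ 1/(1 − x/a), 1 ≤ a ≤ m.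
  ρ σ : ℕ → Carrier
  ρ zero    = 0#
  ρ (suc c) = ρ c + proj₁ (ι⁻¹ c)
  σ zero    = 0#
  σ (suc c) = σ c + (ρ c * proj₁ (ι⁻¹ c) + proj₁ (ι⁻¹ c) * proj₁ (ι⁻¹ c))

  Round-0 : ∀ {m} c → c ℕ.≤ m → Split (Grid m 0 c) (Round c (D 0# 0)) (D 0# 0)
  Round-0 zero    _   = Split-refl
  Round-0 (suc c) c<m = Round-step c c<m (Round-0 c (ℕₚ.<⇒≤ c<m)) (U-split-0 c<m)

  Round-1 : ∀ {m} c → c ℕ.≤ m → Split (Grid m 0 c) (Round c (D 0# 1)) (D 0# 1 ⊕ ρ c ⊙ D 0# 0)
  Round-1 zero    _   = Split-resp (λ _ → refl) (λ e → sym (trans (+-congˡ (zeroˡ _)) (+-identityʳ _))) Split-refl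
  Round-1 (suc c) c<m = Round-step c c<m (Round-1 c (ℕₚ.<⇒≤ c<m))
    (Split-resp (λ e → sym (trans (U-⊕ a _ _ e) (+-congˡ (U-⊙ a _ _ e))))
      (λ e → solve 4 (λ x y r s → (x :+ r :* y) :+ s :* y := x :+ (s :+ r) :* y) refl (D 0# 1 e) (D 0# 0 e) (proj₁ (ι⁻¹ c)) (ρ c))
      (Split-⊕ (U-split-suc c<m 0 (U-split-0 c<m)) (Split-⊙ (ρ c) (U-split-0 c<m))))
    where a = ι (suc c)

  Round-2 : ∀ {m} c → c ℕ.≤ m →
    Split (Grid m 0 c) (Round c (D 0# 2)) (D 0# 2 ⊕ ρ c ⊙ D 0# 1 ⊕ σ c ⊙ D 0# 0)
  Round-2 zero    _   = Split-resp (λ _ → refl)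
    (λ e → solve 3 (λ x y z → x := x :+ con (+ 0) :* y :+ con (+ 0) :* z) refl _ _ _) Split-refl
  Round-2 (suc c) c<m = Round-step c c<m (Round-2 c (ℕₚ.<⇒≤ c<m))
    (Split-resp
      (λ e → sym (trans (U-⊕ a _ _ e) (+-cong (trans (U-⊕ a _ _ e) (+-congˡ (U-⊙ a _ _ e))) (U-⊙ a _ _ e))))
      (λ e → solve 6 (λ x y z r s t →
          (x :+ r :* (y :+ r :* z)) :+ s :* (y :+ r :* z) :+ t :* z
            := x :+ (s :+ r) :* y :+ (t :+ (s :* r :+ r :* r)) :* z)
        refl (D 0# 2 e) (D 0# 1 e) (D 0# 0 e) (proj₁ (ι⁻¹ c)) (ρ c) (σ c))
      (Split-⊕ (Split-⊕ (U-split-suc c<m 1 s₁) (Split-⊙ (ρ c) s₁)) (Split-⊙ (σ c) (U-split-0 c<m))))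
    where
    a = ι (suc c)
    s₁ = U-split-suc c<m 0 (U-split-0 c<m)

  -- Divided difference functionals.

  record Dual (m q p : ℕ) (z : Seq) : Set (c ⊔ ℓ) where
    constructor dual
    field
      {φ}    : Seq
      vanish : ∀ e → e ℕ.< q ℕ.+ m ℕ.* p → φ e ≈ 0#
      at-0   : Split (NonZeroPts m p) φ z

  -- For p = 0 the functional extracts the coefficient of x^q.
  Dual-start : ∀ m q → Dual m q 0 (D 0# q)
  Dual-start m q = dual
    (λ e e<q → *-0ˡ (reflexive (≡.cong ι (k>n⇒nCk≡0 (≡.subst (e ℕ.<_) q+m0≡q e<q)))))
    Split-refl
    where q+m0≡q = ≡.trans (≡.cong (q ℕ.+_) (ℕₚ.*-zeroʳ m)) (ℕₚ.+-identityʳ q)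

  -- A pass kills m more degrees and multiplies the part at 0 by ∏ₐ 1/(1 - x/a).
  Dual-step : ∀ {m q p z z′} → Dual m q p z → Split (Grid m 0 m) (Round m z) z′ → Dual m q (suc p) z′
  Dual-step {m} {q} {p} (dual {φ} v (split s eq)) t = dual
    (λ e e<N → Round-vanish m (q ℕ.+ m ℕ.* p) v e (≡.subst (e ℕ.<_) N-eq e<N))
    (Split-trans
      (split (Span-map up (Round-Span m ℕₚ.≤-refl (Span-map embed s)))
             (λ e → trans (Round-cong m eq e) (Round-⊕ m _ _ e)))
      (Split-map up₀ t))
    where
    N-eq : q ℕ.+ m ℕ.* suc p ≡ q ℕ.+ m ℕ.* p ℕ.+ m
    N-eq = ≡.trans (≡.cong (q ℕ.+_) (≡.trans (ℕₚ.*-suc m p) (ℕₚ.+-comm m _))) (≡.sym (ℕₚ.+-assoc q _ m))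
    embed : ∀ {b j} → NonZeroPts m p b j → Grid m p 0 b j
    embed (1≤b , b≤m , j<p) = 1≤b , b≤m , inj₁ j<p
    up : ∀ {b j} → Grid m p m b j → NonZeroPts m (suc p) b j
    up (1≤b , b≤m , inj₁ j<p)       = 1≤b , b≤m , ℕₚ.m≤n⇒m≤1+n j<p
    up (1≤b , b≤m , inj₂ (j≤p , _)) = 1≤b , b≤m , s≤s j≤p
    up₀ : ∀ {b j} → Grid m 0 m b j → NonZeroPts m (suc p) b j
    up₀ (1≤b , b≤m , inj₂ (j≤0 , _)) = 1≤b , b≤m , s≤s (ℕₚ.≤-trans j≤0 z≤n)

  Dual-Lead : ∀ m q p → ∃[ z ] (Lead q z × Dual m q p z)
  Dual-Lead m q zero    = D 0# q , Split-refl , Dual-start m q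
  Dual-Lead m q (suc p) with Dual-Lead m q p
  ... | (_ , l , d) with Round-Lead q m ℕₚ.≤-refl l
  ... | (_ , l′ , s) = _ , l′ , Dual-step d s

  Dual-resp : ∀ {m q p z z′} → z ≐ z′ → Dual m q p z → Dual m q p z′
  Dual-resp eq (dual v s) = dual v (Split-resp (λ _ → refl) eq s)

  Dual-0 : ∀ m p → Dual m 0 p (D 0# 0)
  Dual-0 m zero    = Dual-start m 0
  Dual-0 m (suc p) = Dual-step (Dual-0 m p) (Round-0 m ℕₚ.≤-refl)

  -- The coefficient of x in ∏ₐ (1 - x/a)^(-p) is pρ.
  z₁ : ℕ → ℕ → Seq
  z₁ m p = D 0# 1 ⊕ (ι p * ρ m) ⊙ D 0# 0

  Dual-1 : ∀ m p → Dual m 1 p (z₁ m p)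
  Dual-1 m zero    = Dual-resp
    (λ e → solve 3 (λ x y r → x := x :+ (con (+ 0) :* r) :* y) refl _ _ _) (Dual-start m 1)
  Dual-1 m (suc p) = Dual-step (Dual-1 m p)
    (Split-resp (λ e → sym (trans (Round-⊕ m _ _ e) (+-congˡ (Round-⊙ m _ _ e))))
      (λ e → trans (solve 4 (λ x y r s → (x :+ r :* y) :+ (s :* r) :* y := x :+ (r :+ s :* r) :* y) refl (D 0# 1 e) (D 0# 0 e) (ρ m) (ι p))
         (+-congˡ (*-congʳ (trans (+-congʳ (sym (*-identityˡ _))) (sym (distribʳ _ _ _))))))
      (Split-⊕ (Round-1 m ℕₚ.≤-refl) (Split-⊙ (ι p * ρ m) (Round-0 m ℕₚ.≤-refl))))

  -- The coefficient of x² in ∏ₐ (1 - x/a)^(-p): one more factor 1 + ρx + σx² + ⋯ adds σ + (pρ)ρ.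
  w₂ : ℕ → ℕ → Carrier
  w₂ m zero    = 0#
  w₂ m (suc p) = w₂ m p + (σ m + (ι p * ρ m) * ρ m)

  z₂ : ℕ → ℕ → Seq
  z₂ m p = D 0# 2 ⊕ (ι p * ρ m) ⊙ D 0# 1 ⊕ w₂ m p ⊙ D 0# 0

  Dual-2 : ∀ m p → Dual m 2 p (z₂ m p)
  Dual-2 m zero    = Dual-resp
    (λ e → solve 4 (λ x y z r → x := x :+ (con (+ 0) :* r) :* y :+ con (+ 0) :* z) refl _ _ _ _) (Dual-start m 2)
  Dual-2 m (suc p) = Dual-step (Dual-2 m p)
    (Split-resp
      (λ e → sym (trans (Round-⊕ m _ _ e) (+-cong (trans (Round-⊕ m _ _ e) (+-congˡ (Round-⊙ m _ _ e))) (Round-⊙ m _ _ e))))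
      (λ e → trans (solve 7 (λ x y z r s t w →
          (x :+ r :* y :+ t :* z) :+ (s :* r) :* (y :+ r :* z) :+ w :* z
            := x :+ (r :+ s :* r) :* y :+ (w :+ (t :+ (s :* r) :* r)) :* z)
          refl (D 0# 2 e) (D 0# 1 e) (D 0# 0 e) (ρ m) (ι p) (σ m) (w₂ m p))
        (+-congʳ (+-congˡ (*-congʳ (trans (+-congʳ (sym (*-identityˡ _))) (sym (distribʳ _ _ _)))))))
      (Split-⊕ (Split-⊕ (Round-2 m ℕₚ.≤-refl) (Split-⊙ (ι p * ρ m) (Round-1 m ℕₚ.≤-refl)))
               (Split-⊙ (w₂ m p) (Round-0 m ℕₚ.≤-refl))))

  -- Tensor products of functionals

  Form : ℕ → Set c
  Form n = Vec ℕ n → Carrier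

  infixr 5 _⊗_
  _⊗_ : ∀ {n} → Seq → Form n → Form (suc n)
  (φ ⊗ F) (e ∷ α) = φ e * F α

  ⨂ : ∀ {n} → Vec Seq n → Form n
  ⨂ []       _ = 1#
  ⨂ (φ ∷ φs)   = φ ⊗ ⨂ φs

  𝔻 : ∀ {n} → Vec ℕ n → Vec ℕ n → Form n
  𝔻 bs js = ⨂ (Vec.zipWith (λ b j → D (ι b) j) bs js)

  record Linear {n : ℕ} (L : Form n → Carrier) : Set (c ⊔ ℓ) where
    field
      L-cong : ∀ {F G} → (∀ α → F α ≈ G α) → L F ≈ L G
      L-+    : ∀ F G → L (λ α → F α + G α) ≈ L F + L G
      L-*    : ∀ k F → L (λ α → k * F α) ≈ k * L F

  module _ {n} {L : Form (suc n) → Carrier} (lin : Linear L) where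
    open Linear lin

    -- Fixing the first factor leaves a linear form in the remaining variables; this drives the
    -- inductions on the number of variables.
    L-⊗ : ∀ φ → Linear (λ F → L (φ ⊗ F))
    L-⊗ φ = record
      { L-cong = λ F≈G → L-cong λ { (e ∷ α) → *-congˡ (F≈G α) }
      ; L-+    = λ F G → trans (L-cong λ { (e ∷ α) → distribˡ _ _ _ }) (L-+ _ _)
      ; L-*    = λ k F → trans (L-cong λ { (e ∷ α) → solve 3 (λ x y z → x :* (y :* z) := y :* (x :* z)) refl _ _ _ }) (L-* _ _)
      }

    L-congˡ : ∀ {φ ψ} F → φ ≐ ψ → L (φ ⊗ F) ≈ L (ψ ⊗ F)
    L-congˡ F eq = L-cong λ { (e ∷ α) → *-congʳ (eq e) }

    L-⊕ : ∀ φ ψ F → L ((φ ⊕ ψ) ⊗ F) ≈ L (φ ⊗ F) + L (ψ ⊗ F)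
    L-⊕ φ ψ F = trans (L-cong λ { (e ∷ α) → distribʳ _ _ _ }) (L-+ _ _)

    L-⊙ : ∀ k φ F → L ((k ⊙ φ) ⊗ F) ≈ k * L (φ ⊗ F)
    L-⊙ k φ F = trans (L-cong λ { (e ∷ α) → *-assoc _ _ _ }) (L-* _ _)

    L-𝟘 : ∀ F → L (𝟘 ⊗ F) ≈ 0#
    L-𝟘 F = trans (L-congˡ F (λ e → sym (zeroˡ 0#))) (trans (L-⊙ 0# 𝟘 F) (zeroˡ _))

    L-Span : ∀ {A φ} F → (∀ {b j} → A b j → L (D (ι b) j ⊗ F) ≈ 0#) → Span A φ → L (φ ⊗ F) ≈ 0#
    L-Span F h (gen x)     = h x
    L-Span F h zer         = L-𝟘 F
    L-Span F h (add s t)   = trans (L-⊕ _ _ F) (+-0 (L-Span F h s) (L-Span F h t))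
    L-Span F h (scl k s)   = trans (L-⊙ k _ F) (*-0ʳ (L-Span F h s))
    L-Span F h (resp eq s) = trans (L-congˡ F (λ e → sym (eq e))) (L-Span F h s)

    L-Split : ∀ {A φ z} F → (∀ {b j} → A b j → L (D (ι b) j ⊗ F) ≈ 0#) → Split A φ z → L (φ ⊗ F) ≈ L (z ⊗ F)
    L-Split F h (split s eq) = trans (L-congˡ F eq)
      (trans (L-⊕ _ _ F) (trans (+-congˡ (L-Span F h s)) (+-identityʳ _)))

    L-Span-cong : ∀ {A φ} F G → (∀ {b j} → A b j → L (D (ι b) j ⊗ F) ≈ L (D (ι b) j ⊗ G)) → Span A φ → L (φ ⊗ F) ≈ L (φ ⊗ G)
    L-Span-cong F G h (gen x)     = h x
    L-Span-cong F G h zer         = trans (L-𝟘 F) (sym (L-𝟘 G))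
    L-Span-cong F G h (add s t)   = trans (L-⊕ _ _ F) (trans (+-cong (L-Span-cong F G h s) (L-Span-cong F G h t)) (sym (L-⊕ _ _ G)))
    L-Span-cong F G h (scl k s)   = trans (L-⊙ k _ F) (trans (*-congˡ (L-Span-cong F G h s)) (sym (L-⊙ k _ G)))
    L-Span-cong F G h (resp eq s) = trans (L-congˡ F (λ e → sym (eq e))) (trans (L-Span-cong F G h s) (L-congˡ G eq))

  data Spans {A : Set} (Ok : A → ℕ → ℕ → Set) : ∀ {n} → Vec A n → Vec Seq n → Set (c ⊔ ℓ) where
    []  : Spans Ok [] []
    _∷_ : ∀ {n o φ} {os : Vec A n} {φs} → Span (Ok o) φ → Spans Ok os φs → Spans Ok (o ∷ os) (φ ∷ φs)

  data Oks {A : Set} (Ok : A → ℕ → ℕ → Set) : ∀ {n} → Vec A n → Vec ℕ n → Vec ℕ n → Set where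
    []  : Oks Ok [] [] []
    _∷_ : ∀ {n o b j} {os : Vec A n} {bs js} → Ok o b j → Oks Ok os bs js → Oks Ok (o ∷ os) (b ∷ bs) (j ∷ js)

  L-Spans : ∀ {A : Set} {Ok : A → ℕ → ℕ → Set} {n} {L : Form n → Carrier} → Linear L → ∀ {os : Vec A n} {φs} →
    Spans Ok os φs → (∀ {bs js} → Oks Ok os bs js → L (𝔻 bs js) ≈ 0#) → L (⨂ φs) ≈ 0#
  L-Spans lin []       h = h []
  L-Spans lin (s ∷ ss) h = L-Span lin _ (λ x → L-Spans (L-⊗ lin _) ss (λ xs → h (x ∷ xs))) s

  -- Tensor products of the dual functionals.

  Pt : ℕ → ℕ → ℕ → ℕ → Set
  Pt m o b j = b ℕ.≤ m × j ℕ.≤ o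

  -- One tensor factor: order `q` is read off at 0, orders up to `o` may occur at the points 0, ...,
  -- m, and the divided difference has p = o + 1.
  record Spec (m : ℕ) : Set (c ⊔ ℓ) where
    constructor spec
    field
      {q} {o} : ℕ
      {z}     : Seq
      q≤o     : q ℕ.≤ o
      lead    : Lead q z
      dual-z  : Dual m q (suc o) z
    open Dual dual-z public
  open Spec public using () renaming (q to ord₀; o to ord; z to z-of; φ to φ-of)

  ords : ∀ {m n} → Vec (Spec m) n → Vec ℕ n
  ords = Vec.map ord

  ords₀ : ∀ {m n} → Vec (Spec m) n → Vec ℕ n
  ords₀ = Vec.map ord₀

  Lead-Span : ∀ {q z} → Lead q z → Span (λ b j → b ≡ 0 × j ℕ.≤ q) z
  Lead-Span (split s eq) = resp (λ e → sym (eq e))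
    (add (gen (≡.refl , ℕₚ.≤-refl)) (Span-map (λ { (b≡0 , j<q) → b≡0 , ℕₚ.<⇒≤ j<q }) s))

  Spans-φ : ∀ {m n} (ss : Vec (Spec m) n) → Spans (Pt m) (ords ss) (Vec.map φ-of ss)
  Spans-φ [] = []
  Spans-φ (spec q≤o l (dual _ (split s eq)) ∷ ss) =
    resp (λ e → sym (eq e)) (add
      (Span-map (λ { (≡.refl , j≤q) → z≤n , ℕₚ.≤-trans j≤q q≤o }) (Lead-Span l))
      (Span-map (λ { (_ , b≤m , s≤s j≤o) → b≤m , j≤o }) s)) ∷ Spans-φ ss

  Spans-z : ∀ {m n} (ss : Vec (Spec m) n) → Spans (λ q b j → b ≡ 0 × j ℕ.≤ q) (ords₀ ss) (Vec.map z-of ss)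
  Spans-z []       = []
  Spans-z (s ∷ ss) = Lead-Span (Spec.lead s) ∷ Spans-z ss

  -- Expand the factors one at a time into point functionals: terms with a nonzero coordinate are
  -- annihilated by hypothesis, and the rest make up the product of the `z`.
  L-φ≈L-z : ∀ {m n} {L : Form n → Carrier} → Linear L → (ss : Vec (Spec m) n) →
    (∀ {bs js} → Oks (Pt m) (ords ss) bs js → bs ≢ Vec.replicate n 0 → L (𝔻 bs js) ≈ 0#) →
    L (⨂ (Vec.map φ-of ss)) ≈ L (⨂ (Vec.map z-of ss))
  L-φ≈L-z lin [] h = refl
  L-φ≈L-z lin (spec q≤o l (dual _ spl) ∷ ss) h = trans
    (L-Split lin _
      (λ { (s≤s 1≤b , b≤m , s≤s j≤o) → L-Spans (L-⊗ lin _) (Spans-φ ss) (λ xs → h ((b≤m , j≤o) ∷ xs) λ ()) })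
      spl)
    (L-Span-cong lin _ _
      -- If the first coordinate is 0, being away from the origin is a condition on the remaining
      -- ones alone.
      (λ { (≡.refl , j≤q) → L-φ≈L-z (L-⊗ lin _) ss (λ xs bs≢0 → h ((z≤n , ℕₚ.≤-trans j≤q q≤o) ∷ xs) (bs≢0 ∘ Vecₚ.∷-injectiveʳ)) })
      (Lead-Span l))

  Oks-≤ : ∀ {n} {qs bs js : Vec ℕ n} → Oks (λ q b j → b ≡ 0 × j ℕ.≤ q) qs bs js →
    bs ≡ Vec.replicate n 0 × ∣ js ∣ ℕ.≤ ∣ qs ∣
  Oks-≤ [] = ≡.refl , z≤n
  Oks-≤ ((≡.refl , j≤q) ∷ xs) with Oks-≤ xs
  ... | (≡.refl , le) = ≡.refl , ℕₚ.+-mono-≤ j≤q le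

  -- Every term other than the product of the top terms has smaller total order and vanishes.
  L-z≈L-𝔻 : ∀ {m n} {L : Form n → Carrier} → Linear L → (ss : Vec (Spec m) n) →
    (∀ js → ∣ js ∣ ℕ.< ∣ ords₀ ss ∣ → L (𝔻 (Vec.replicate n 0) js) ≈ 0#) →
    L (⨂ (Vec.map z-of ss)) ≈ L (𝔻 (Vec.replicate n 0) (ords₀ ss))
  L-z≈L-𝔻 lin [] h = refl
  L-z≈L-𝔻 {L = L} lin (spec {q} {o} q≤o l d ∷ ss) h = trans
    (L-Split lin _ low l)
    (L-z≈L-𝔻 (L-⊗ lin _) ss (λ js lt → h (q ∷ js) (ℕₚ.+-monoʳ-< q lt)))
    where
    low : ∀ {b j} → Low q b j → L (D (ι b) j ⊗ ⨂ (Vec.map z-of ss)) ≈ 0#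
    low (≡.refl , j<q) = L-Spans (L-⊗ lin _) (Spans-z ss) λ xs → case Oks-≤ xs of λ
      { (≡.refl , le) → h (_ ∷ _) (ℕₚ.+-mono-<-≤ j<q le) }

  Spec-total : ∀ {m n} → Vec (Spec m) n → ℕ
  Spec-total {m} ss = ∣ Vec.map (λ s → ord₀ s ℕ.+ m ℕ.* suc (ord s)) ss ∣

  -- Pigeonhole: some exponent lies below its own threshold, and that factor kills the monomial.
  ⨂φ-vanish : ∀ {m n} (ss : Vec (Spec m) n) α → ∣ α ∣ ℕ.< Spec-total ss → ⨂ (Vec.map φ-of ss) α ≈ 0#
  ⨂φ-vanish {m} (s ∷ ss) (e ∷ α) lt with e ℕ.<? ord₀ s ℕ.+ m ℕ.* suc (ord s)
  ... | yes e<N = *-0ˡ (Spec.vanish s e e<N)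
  ... | no  e≮N = *-0ʳ (⨂φ-vanish ss α (ℕₚ.+-cancelˡ-< e _ _ (ℕₚ.<-≤-trans lt (ℕₚ.+-monoˡ-≤ _ (ℕₚ.≮⇒≥ e≮N)))))

  Spec-total≡ : ∀ {m n} (ss : Vec (Spec m) n) → Spec-total ss ≡ ∣ ords₀ ss ∣ ℕ.+ m ℕ.* (n ℕ.+ ∣ ords ss ∣)
  Spec-total≡ {m} [] = ≡.sym (ℕₚ.*-zeroʳ m)
  Spec-total≡ {m} {suc n} (s ∷ ss) = ≡.trans (≡.cong (ord₀ s ℕ.+ m ℕ.* suc (ord s) ℕ.+_) (Spec-total≡ ss))
    (rearrange (ord₀ s) m (ord s) (∣ ords₀ ss ∣) n (∣ ords ss ∣))
    where
    rearrange : ∀ a m b c n d → a ℕ.+ m ℕ.* suc b ℕ.+ (c ℕ.+ m ℕ.* (n ℕ.+ d)) ≡ a ℕ.+ c ℕ.+ m ℕ.* (suc n ℕ.+ (b ℕ.+ d))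
    rearrange = solve-∀

  -- Finite sums and the pairing of a polynomial with a form.

  ∑ : ∀ {a} {A : Set a} → (A → Carrier) → List A → Carrier
  ∑ f xs = sumL (List.map f xs)

  ∑-cong : ∀ {a} {A : Set a} {f g : A → Carrier} → (∀ x → f x ≈ g x) → ∀ xs → ∑ f xs ≈ ∑ g xs
  ∑-cong f≈g []       = refl
  ∑-cong f≈g (x ∷ xs) = +-cong (f≈g x) (∑-cong f≈g xs)

  ∑-+ : ∀ {a} {A : Set a} (f g : A → Carrier) xs → ∑ (λ x → f x + g x) xs ≈ ∑ f xs + ∑ g xs
  ∑-+ f g []       = sym (+-identityʳ _)
  ∑-+ f g (x ∷ xs) = trans (+-congˡ (∑-+ f g xs))
    (solve 4 (λ a b c d → (a :+ b) :+ (c :+ d) := (a :+ c) :+ (b :+ d)) refl _ _ _ _)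

  ∑-* : ∀ {a} {A : Set a} k (f : A → Carrier) xs → ∑ (λ x → k * f x) xs ≈ k * ∑ f xs
  ∑-* k f []       = sym (zeroʳ _)
  ∑-* k f (x ∷ xs) = trans (+-congˡ (∑-* k f xs)) (sym (distribˡ _ _ _))

  ∑-≉0 : ∀ {a} {A : Set a} (f : A → Carrier) xs → ∑ f xs ≉0 → ∃[ x ] (f x ≉0)
  ∑-≉0 f []       s≉0 = ⊥-elim (s≉0 refl)
  ∑-≉0 f (x ∷ xs) s≉0 with f x ≈? 0#
  ... | no  fx≉0 = x , fx≉0
  ... | yes fx≈0 = ∑-≉0 f xs (λ s≈0 → s≉0 (+-0 fx≈0 s≈0))

  -- The value on P of the functional that sends the monomial x^α to F α.
  ⟪_⟫ : ∀ {n} → Poly n → Form n → Carrier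
  ⟪_⟫ {n} P F = ∑ (λ α → coef P α * F α) (box (bound P) n)

  ⟪⟫-linear : ∀ {n} (P : Poly n) → Linear ⟪ P ⟫
  ⟪⟫-linear {n} P = record
    { L-cong = λ F≈G → ∑-cong (λ α → *-congˡ (F≈G α)) bx
    ; L-+    = λ F G → trans (∑-cong (λ α → distribˡ _ _ _) bx) (∑-+ _ _ bx)
    ; L-*    = λ k F → trans (∑-cong (λ α → solve 3 (λ x y z → x :* (y :* z) := y :* (x :* z)) refl _ _ _) bx) (∑-* k _ bx)
    }
    where bx = box (bound P) n

  prodV-⨂ : ∀ {n} (a : Vec Carrier n) (β α : Vec ℕ n) →
    prodV (Vec.zipWith _*_ (Vec.zipWith (λ αᵢ βᵢ → ι (αᵢ C βᵢ)) α β) (Vec.zipWith _^ᵣ_ a (Vec.zipWith _∸_ α β)))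
      ≈ ⨂ (Vec.zipWith D a β) α
  prodV-⨂ []      []      []      = refl
  prodV-⨂ (a ∷ as) (b ∷ β) (e ∷ α) = *-congˡ (prodV-⨂ as β α)

  shiftCoef-⨂ : ∀ {n} (P : Poly n) a β → shiftCoef P a β ≈ ⟪ P ⟫ (⨂ (Vec.zipWith D a β))
  shiftCoef-⨂ {n} P a β = ∑-cong (λ α → *-congˡ (prodV-⨂ a β α)) (box (bound P) n)

  zipWith-D-ι : ∀ {n} (bs js : Vec ℕ n) → Vec.zipWith D (Vec.map ι bs) js ≡ Vec.zipWith (λ b j → D (ι b) j) bs js
  zipWith-D-ι []       []       = ≡.refl
  zipWith-D-ι (b ∷ bs) (j ∷ js) = ≡.cong (D (ι b) j ∷_) (zipWith-D-ι bs js)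

  shiftCoef-𝔻 : ∀ {n} (P : Poly n) bs β → shiftCoef P (Vec.map ι bs) β ≈ ⟪ P ⟫ (𝔻 bs β)
  shiftCoef-𝔻 P bs β = trans (shiftCoef-⨂ P (Vec.map ι bs) β) (reflexive (≡.cong (⟪ P ⟫ ∘ ⨂) (zipWith-D-ι bs β)))

  shiftCoef-0 : ∀ {n} (P : Poly n) β → shiftCoef P (Vec.replicate n 0#) β ≈ ⟪ P ⟫ (𝔻 (Vec.replicate n 0) β)
  shiftCoef-0 {n} P β = trans (reflexive (≡.cong (λ a → shiftCoef P a β) (≡.sym (Vecₚ.map-replicate ι 0 n))))
    (shiftCoef-𝔻 P (Vec.replicate n 0) β)

  -- A nonzero pairing has a nonzero summand, and its monomial cannot lie below the threshold, where
  -- the functional vanishes.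
  ⟪⟫-≉0⇒DegAtLeast : ∀ {m n} (P : Poly n) (ss : Vec (Spec m) n) →
    ⟪ P ⟫ (⨂ (Vec.map φ-of ss)) ≉0 → DegAtLeast P (Spec-total ss)
  ⟪⟫-≉0⇒DegAtLeast {n = n} P ss v≉0 with ∑-≉0 _ (box (bound P) n) v≉0
  ... | (α , x≉0) = α , ℕₚ.≮⇒≥ (λ lt → *-≉0ʳ x≉0 (⨂φ-vanish ss α lt)) , *-≉0ˡ x≉0

  Oks-Pt : ∀ {m n} {os bs js : Vec ℕ n} → Oks (Pt m) os bs js → All (ℕ._≤ m) bs × ∣ js ∣ ℕ.≤ ∣ os ∣
  Oks-Pt []                = [] , z≤n
  Oks-Pt ((b≤m , j≤o) ∷ xs) with Oks-Pt xs
  ... | (bs≤m , le) = b≤m ∷ bs≤m , ℕₚ.+-mono-≤ j≤o le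

  -- The point functionals in the expansion have total order at most |ords ss| < k, so those away
  -- from the origin annihilate P.
  admissible⇒φ≈z : ∀ {m n k l} (P : Poly n) → Admissible m n k l P → (ss : Vec (Spec m) n) → ∣ ords ss ∣ ℕ.< k →
    ⟪ P ⟫ (⨂ (Vec.map φ-of ss)) ≈ ⟪ P ⟫ (⨂ (Vec.map z-of ss))
  admissible⇒φ≈z P (away , _) ss lt = L-φ≈L-z (⟪⟫-linear P) ss λ {bs} {js} xs bs≢0 →
    let (bs≤m , le) = Oks-Pt xs in
    trans (sym (shiftCoef-𝔻 P bs js)) (away bs bs≤m bs≢0 js (ℕₚ.≤-<-trans le lt))

  -- Lower bounds

  -- A negative inverse would make -1 positive.
  r-pos : ∀ m → 0# <ᵣ proj₁ (ι⁻¹ m)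
  r-pos m with <-trichot 0# (proj₁ (ι⁻¹ m))
  ... | inj₁ 0<r        = 0<r
  ... | inj₂ (inj₁ 0≈r) = ⊥-elim (1≉0 (trans (sym (proj₂ (ι⁻¹ m))) (*-0ʳ (sym 0≈r))))
  ... | inj₂ (inj₂ r<0) = ⊥-elim (<-irrefl (<-trans 0<1 (<-resp-≈ (+-identityˡ _) 0≈1+-1 (+-mono-< 1# 0<-1))))
    where
    r = proj₁ (ι⁻¹ m)
    0<-r : 0# <ᵣ - r
    0<-r = <-resp-≈ (-‿inverseʳ r) (+-identityˡ _) (+-mono-< (- r) r<0)
    0<-1 : 0# <ᵣ - 1#
    0<-1 = <-resp-≈ refl (trans (sym (-‿distribʳ-* _ _)) (-‿cong (proj₂ (ι⁻¹ m)))) (*-pos (ι-pos m) 0<-r)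
    0≈1+-1 : - 1# + 1# ≈ 0#
    0≈1+-1 = -‿inverseˡ 1#

  ρ-pos : ∀ m → 0# <ᵣ ρ (suc m)
  ρ-nonneg : ∀ m → 0# ≤ᵣ ρ m
  ρ-nonneg zero    = inj₂ refl
  ρ-nonneg (suc m) = inj₁ (ρ-pos m)

  ρ-pos m = <-resp-≈ refl (+-comm _ _) (+-pos-nonneg (r-pos m) (ρ-nonneg m))

  σ-nonneg : ∀ m → 0# ≤ᵣ σ m
  σ-nonneg zero    = inj₂ refl
  σ-nonneg (suc m) = inj₁ (<-resp-≈ refl
    (solve 3 (λ s p r → (p :+ r) :* r :+ s := s :+ (p :* r :+ r :* r)) refl (σ m) (ρ m) (proj₁ (ι⁻¹ m)))
    (+-pos-nonneg (*-pos (ρ-pos m) (r-pos m)) (σ-nonneg m)))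

  -- Orders 0, 1 and 2 come with explicit parts at 0, needed where lower coefficients are compared;
  -- `specₗ` records the leading term only.
  spec₀ : ∀ {m} (o : ℕ) → Spec m
  spec₀ o = spec z≤n Split-refl (Dual-0 _ (suc o))

  spec₁ : ∀ {m} (o : ℕ) → 1 ℕ.≤ o → Spec m
  spec₁ o 1≤o = spec 1≤o (split (scl _ (gen (≡.refl , s≤s z≤n))) (λ _ → refl)) (Dual-1 _ (suc o))

  spec₂ : ∀ {m} (o : ℕ) → 2 ℕ.≤ o → Spec m
  spec₂ o 2≤o = spec 2≤o
    (split (add (scl _ (gen (≡.refl , s≤s (s≤s z≤n)))) (scl _ (gen (≡.refl , s≤s z≤n)))) (λ _ → +-assoc _ _ _))
    (Dual-2 _ (suc o))

  specₗ : ∀ {m} q o → q ℕ.≤ o → Spec m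
  specₗ {m} q o q≤o = let (_ , l , d) = Dual-Lead m q (suc o) in spec q≤o l d

  specs : ∀ {m n} → Vec ℕ n → Vec (Spec m) n
  specs = Vec.map (λ q → specₗ q q ℕₚ.≤-refl)

  ords-specs : ∀ {m n} (β : Vec ℕ n) → ords (specs {m} β) ≡ β
  ords-specs []      = ≡.refl
  ords-specs (b ∷ β) = ≡.cong (b ∷_) (ords-specs β)

  ords₀-specs : ∀ {m n} (β : Vec ℕ n) → ords₀ (specs {m} β) ≡ β
  ords₀-specs []      = ≡.refl
  ords₀-specs (b ∷ β) = ≡.cong (b ∷_) (ords₀-specs β)

  module _ {n} {L : Form (suc n) → Carrier} (lin : Linear L) (m : ℕ) where

    -- Raising p by one changes `z₁` by a multiple ρ of the value at 0, which the difference of the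
    -- two relations isolates.
    z₁-diff : ∀ p F → L (z₁ m p ⊗ F) ≈ 0# → L (z₁ m (suc p) ⊗ F) ≈ 0# → ρ m * L (D 0# 0 ⊗ F) ≈ 0#
    z₁-diff p F e₁ e₂ = begin
      ρ m * L (D 0# 0 ⊗ F)
        ≈⟨ +-identityˡ _ ⟨
      0# + ρ m * L (D 0# 0 ⊗ F)
        ≈⟨ +-congʳ e₁ ⟨
      L (z₁ m p ⊗ F) + ρ m * L (D 0# 0 ⊗ F)
        ≈⟨ +-congˡ (L-⊙ lin _ _ F) ⟨
      L (z₁ m p ⊗ F) + L (ρ m ⊙ D 0# 0 ⊗ F)
        ≈⟨ L-⊕ lin _ _ F ⟨
      L ((z₁ m p ⊕ ρ m ⊙ D 0# 0) ⊗ F)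
        ≈⟨ L-congˡ lin F (λ e → trans
             (solve 4 (λ x y i r → x :+ (i :* r) :* y :+ r :* y := x :+ (r :+ i :* r) :* y) refl (D 0# 1 e) (D 0# 0 e) (ι p) (ρ m))
             (+-congˡ (*-congʳ (trans (+-congʳ (sym (*-identityˡ _))) (sym (distribʳ _ _ _)))))) ⟩
      L (z₁ m (suc p) ⊗ F)
        ≈⟨ e₂ ⟩
      0# ∎

    -- The order 2 terms cancel; what remains are the increments of the coefficients pρ and `w₂`.
    z₂-diff : ∀ p F → L (z₂ m p ⊗ F) ≈ 0# → L (z₂ m (suc p) ⊗ F) ≈ 0# →
      ρ m * L (D 0# 1 ⊗ F) + (σ m + (ι p * ρ m) * ρ m) * L (D 0# 0 ⊗ F) ≈ 0#
    z₂-diff p F e₁ e₂ = begin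
      ρ m * L (D 0# 1 ⊗ F) + w * L (D 0# 0 ⊗ F)
        ≈⟨ +-identityˡ _ ⟨
      0# + (ρ m * L (D 0# 1 ⊗ F) + w * L (D 0# 0 ⊗ F))
        ≈⟨ +-cong e₁ (+-cong (L-⊙ lin _ _ F) (L-⊙ lin _ _ F)) ⟨
      L (z₂ m p ⊗ F) + (L (ρ m ⊙ D 0# 1 ⊗ F) + L (w ⊙ D 0# 0 ⊗ F))
        ≈⟨ +-congˡ (L-⊕ lin _ _ F) ⟨
      L (z₂ m p ⊗ F) + L ((ρ m ⊙ D 0# 1 ⊕ w ⊙ D 0# 0) ⊗ F)
        ≈⟨ L-⊕ lin _ _ F ⟨
      L ((z₂ m p ⊕ (ρ m ⊙ D 0# 1 ⊕ w ⊙ D 0# 0)) ⊗ F)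
        ≈⟨ L-congˡ lin F (λ e → trans
             (solve 7 (λ x y z i r u v → x :+ (i :* r) :* y :+ u :* z :+ (r :* y :+ v :* z)
                 := x :+ (r :+ i :* r) :* y :+ (u :+ v) :* z) refl (D 0# 2 e) (D 0# 1 e) (D 0# 0 e) (ι p) (ρ m) (w₂ m p) w)
             (+-congʳ (+-congˡ (*-congʳ (trans (+-congʳ (sym (*-identityˡ _))) (sym (distribʳ _ _ _))))))) ⟩
      L (z₂ m (suc p) ⊗ F)
        ≈⟨ e₂ ⟩
      0# ∎
      where w = σ m + (ι p * ρ m) * ρ m

  module _ {m n k l} (P : Poly n) (adm : Admissible m n k l P) where

    private
      lin = ⟪⟫-linear P

    Jet : Vec ℕ n → Carrier
    Jet β = ⟪ P ⟫ (𝔻 (Vec.replicate n 0) β)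

    Jet-low : ∀ β → ∣ β ∣ ℕ.< l → Jet β ≈ 0#
    Jet-low β lt = trans (sym (shiftCoef-0 P β)) (proj₁ (proj₂ adm) β lt)

    Jet-top : ∃[ β ] (∣ β ∣ ≡ l × Jet β ≉0)
    Jet-top = let (β , ∣β∣≡l , s≉0) = proj₂ (proj₂ adm) in β , ∣β∣≡l , λ J≈0 → s≉0 (trans (shiftCoef-0 P β) J≈0)

    -- Turns each choice of orders into a linear relation between Taylor coefficients at 0, unless
    -- the degree is already large.
    z≈0⊎deg : (ss : Vec (Spec m) n) → ∣ ords ss ∣ ℕ.< k → ⟪ P ⟫ (⨂ (Vec.map z-of ss)) ≈ 0# ⊎ DegAtLeast P (Spec-total ss)
    z≈0⊎deg ss lt with ⟪ P ⟫ (⨂ (Vec.map z-of ss)) ≈? 0#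
    ... | yes z≈0 = inj₁ z≈0
    ... | no  z≉0 = inj₂ (⟪⟫-≉0⇒DegAtLeast P ss (λ φ≈0 → z≉0 (trans (sym (admissible⇒φ≈z P adm ss lt)) φ≈0)))

    -- The case l = |ords₀ ss|: only the leading term of each zᵢ survives.
    deg-top : (ss : Vec (Spec m) n) → ∣ ords ss ∣ ℕ.< k → ∣ ords₀ ss ∣ ℕ.≤ l → Jet (ords₀ ss) ≉0 → DegAtLeast P (Spec-total ss)
    deg-top ss lt le J≉0 with z≈0⊎deg ss lt
    ... | inj₂ d   = d
    ... | inj₁ z≈0 = ⊥-elim (J≉0 (trans (sym (L-z≈L-𝔻 lin ss (λ js js<q → Jet-low js (ℕₚ.<-≤-trans js<q le)))) z≈0))

  lower-i : ∀ m n k l (P : Poly n) → 1 ℕ.≤ m → 1 ℕ.≤ n → 2 ℕ.≤ k → Admissible m n k l P → l ≡ k ∸ 1 →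
    DegAtLeast P (m ℕ.* n ℕ.+ (m ℕ.+ 1) ℕ.* (k ∸ 1))
  lower-i m n (suc k) .k P _ _ _ adm ≡.refl with Jet-top P adm
  ... | (β , ∣β∣≡k , J≉0) = ≡.subst (DegAtLeast P) total
    (deg-top P adm (specs β)
      (s≤s (ℕₚ.≤-reflexive ∣o∣≡k)) (ℕₚ.≤-reflexive ∣q∣≡k)
      (≡.subst (λ γ → Jet P adm γ ≉0) (≡.sym (ords₀-specs β)) J≉0))
    where
    ∣o∣≡k = ≡.trans (≡.cong ∣_∣ (ords-specs {m} β)) ∣β∣≡k
    ∣q∣≡k = ≡.trans (≡.cong ∣_∣ (ords₀-specs {m} β)) ∣β∣≡k
    rearrange : ∀ m n k → k ℕ.+ m ℕ.* (n ℕ.+ k) ≡ m ℕ.* n ℕ.+ (m ℕ.+ 1) ℕ.* k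
    rearrange = solve-∀
    total : Spec-total (specs {m} β) ≡ m ℕ.* n ℕ.+ (m ℕ.+ 1) ℕ.* k
    total = ≡.trans (Spec-total≡ (specs β)) (≡.trans
      (≡.cong₂ (λ q o → q ℕ.+ m ℕ.* (n ℕ.+ o)) ∣q∣≡k ∣o∣≡k) (rearrange m n k))

  -- Here `k` is the prescribed multiplicity minus 2, so the allowed orders still sum to less than
  -- that multiplicity.
  Bumped : ∀ {m n} → ℕ → Vec (Spec m) n → Set
  Bumped k ss = ∣ ords₀ ss ∣ ≡ k × ∣ ords ss ∣ ≡ suc k

  module _ {m n k l} (P : Poly n) (adm : Admissible m n (suc (suc k)) l P) where

    private
      lin = ⟪⟫-linear P
      d   = m ℕ.* n ℕ.+ (m ℕ.+ 1) ℕ.* suc k ∸ 1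

    bumped-total : ∀ {ss : Vec (Spec m) n} → Bumped k ss → Spec-total ss ≡ d
    bumped-total {ss} (q≡ , o≡) = ≡.trans (Spec-total≡ ss) (≡.trans
      (≡.cong₂ (λ q o → q ℕ.+ m ℕ.* (n ℕ.+ o)) q≡ o≡) (≡.cong (_∸ 1) (rearrange m n k)))
      where
      rearrange : ∀ m n k → suc (k ℕ.+ m ℕ.* (n ℕ.+ suc k)) ≡ m ℕ.* n ℕ.+ (m ℕ.+ 1) ℕ.* suc k
      rearrange = solve-∀

    z≈0⊎deg′ : (ss : Vec (Spec m) n) → Bumped k ss → ⟪ P ⟫ (⨂ (Vec.map z-of ss)) ≈ 0# ⊎ DegAtLeast P d
    z≈0⊎deg′ ss bumped with z≈0⊎deg P adm ss (s≤s (ℕₚ.≤-reflexive (proj₂ bumped)))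
    ... | inj₁ z≈0 = inj₁ z≈0
    ... | inj₂ d   = inj₂ (≡.subst (DegAtLeast P) (bumped-total {ss} bumped) d)

    both : (ss ss′ : Vec (Spec m) n) → Bumped k ss → Bumped k ss′ →
      (⟪ P ⟫ (⨂ (Vec.map z-of ss)) ≈ 0# → ⟪ P ⟫ (⨂ (Vec.map z-of ss′)) ≈ 0# → DegAtLeast P d) → DegAtLeast P d
    both ss ss′ b b′ f with z≈0⊎deg′ ss b | z≈0⊎deg′ ss′ b′
    ... | inj₂ d | _      = d
    ... | inj₁ _ | inj₂ d = d
    ... | inj₁ z | inj₁ z′ = f z z′

  ρ≉0 : ∀ {m} → 1 ℕ.≤ m → ρ m ≉0
  ρ≉0 {suc m} _ = pos⇒≉0 (ρ-pos m)

  σ+ρ²≉0 : ∀ {m} → 1 ℕ.≤ m → σ m + ρ m * ρ m ≉0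
  σ+ρ²≉0 {suc m} _ = pos⇒≉0 (<-resp-≈ refl (+-comm _ _) (+-pos-nonneg (*-pos (ρ-pos m) (ρ-pos m)) (σ-nonneg (suc m))))

  bumped-specs : ∀ {m n} (β : Vec ℕ n) {x x′ y y′ : ℕ} → x ℕ.+ ∣ β ∣ ≡ y → x′ ℕ.+ ∣ β ∣ ≡ y′ →
    x ℕ.+ ∣ ords₀ (specs {m} β) ∣ ≡ y × x′ ℕ.+ ∣ ords (specs {m} β) ∣ ≡ y′
  bumped-specs {m} β {x} {x′} p q =
    ≡.trans (≡.cong (λ γ → x ℕ.+ ∣ γ ∣) (ords₀-specs {m} β)) p , ≡.trans (≡.cong (λ γ → x′ ℕ.+ ∣ γ ∣) (ords-specs {m} β)) q

  -- When l is the multiplicity minus 2 the leading terms suffice; the extra order goes to the first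
  -- coordinate.
  lower-top : ∀ {m n k} (P : Poly n) → 1 ℕ.≤ n → Admissible m n (suc (suc k)) k P →
    DegAtLeast P (m ℕ.* n ℕ.+ (m ℕ.+ 1) ℕ.* suc k ∸ 1)
  lower-top {m} {suc n} {k} P (s≤s _) adm with Jet-top P adm
  ... | (b ∷ β , ∣β∣≡k , J≉0) = ≡.subst (DegAtLeast P) (bumped-total P adm {ss} bumped)
    (deg-top P adm ss (s≤s (ℕₚ.≤-reflexive (proj₂ bumped))) (ℕₚ.≤-reflexive (proj₁ bumped))
      (≡.subst (λ γ → Jet P adm (b ∷ γ) ≉0) (≡.sym (ords₀-specs β)) J≉0))
    where
    ss : Vec (Spec m) (suc n)
    ss = specₗ b (suc b) (ℕₚ.n≤1+n b) ∷ specs β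
    bumped : Bumped k ss
    bumped = bumped-specs β {b} {suc b} ∣β∣≡k (≡.cong suc ∣β∣≡k)

  L-specs : ∀ {m n} {L : Form n → Carrier} → Linear L → (β : Vec ℕ n) →
    (∀ js → ∣ js ∣ ℕ.< ∣ β ∣ → L (𝔻 (Vec.replicate n 0) js) ≈ 0#) →
    L (⨂ (Vec.map z-of (specs {m} β))) ≈ L (𝔻 (Vec.replicate n 0) β)
  L-specs {m} {n} {L} lin β h = trans
    (L-z≈L-𝔻 lin (specs β) (λ js lt → h js (≡.subst (λ γ → ∣ js ∣ ℕ.< ∣ γ ∣) (ords₀-specs {m} β) lt)))
    (reflexive (≡.cong (λ γ → L (𝔻 (Vec.replicate n 0) γ)) (ords₀-specs {m} β)))

  -- The extra order is put once on the second coordinate, whose part at 0 does not depend on it,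
  -- and once on the first, where it changes `z₁`. The difference isolates the coefficient at (0, 0,
  -- β).
  lower-00 : ∀ {m n l} (P : Poly (suc (suc n))) → 1 ℕ.≤ m → (adm : Admissible m (suc (suc n)) (3 ℕ.+ l) l P) →
    ∀ β → ∣ β ∣ ≡ l → Jet P adm (0 ∷ 0 ∷ β) ≉0 →
    DegAtLeast P (m ℕ.* suc (suc n) ℕ.+ (m ℕ.+ 1) ℕ.* suc (suc l) ∸ 1)
  lower-00 {m} P 1≤m adm β ∣β∣≡l J≉0 = both P adm
    (spec₁ 1 (s≤s z≤n) ∷ spec₀ 1 ∷ specs β) (spec₁ 2 (s≤s z≤n) ∷ spec₀ 0 ∷ specs β)
    (bumped-specs β (≡.cong suc ∣β∣≡l) (≡.cong (2 ℕ.+_) ∣β∣≡l))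
    (bumped-specs β (≡.cong suc ∣β∣≡l) (≡.cong (2 ℕ.+_) ∣β∣≡l))
    λ e₁ e₂ → ⊥-elim (J≉0 (trans
      (sym (L-specs (L-⊗ (L-⊗ lin (D 0# 0)) (D 0# 0)) β
        (λ js lt → Jet-low P adm (0 ∷ 0 ∷ js) (≡.subst (∣ js ∣ ℕ.<_) ∣β∣≡l lt))))
      -- Order o means p = o + 1, so the orders 1 and 2 give p = 2 and p = 3.
      (x*y≈0⇒y≈0 (ρ≉0 1≤m) (z₁-diff lin m 2 _ e₁ e₂))))
    where lin = ⟪⟫-linear P

  -- The single 1 of the index lies beyond the second coordinate, on it, or on the first; only the
  -- last case calls for `z₂`.
  lower-4-1 : ∀ {m n} (P : Poly (3 ℕ.+ n)) → 1 ℕ.≤ m → Admissible m (3 ℕ.+ n) 4 1 P →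
    DegAtLeast P (m ℕ.* (3 ℕ.+ n) ℕ.+ (m ℕ.+ 1) ℕ.* 3 ∸ 1)
  lower-4-1 {m} P 1≤m adm with Jet-top P adm
  ... | (0 ∷ 0 ∷ β , ∣β∣≡1 , J≉0) = lower-00 P 1≤m adm β ∣β∣≡1 J≉0
  -- The lower term of the second factor contributes a coefficient of order 0 < l, so only the index
  -- (0, 1, 0, β) survives.
  ... | (0 ∷ 1 ∷ 0 ∷ β , ∣β∣≡1 , J≉0) = both P adm
    (spec₁ 1 (s≤s z≤n) ∷ spec₁ 1 (s≤s z≤n) ∷ spec₀ 1 ∷ specs β) (spec₁ 2 (s≤s z≤n) ∷ spec₁ 1 (s≤s z≤n) ∷ spec₀ 0 ∷ specs β)
    (bumped-specs β (≡.cong suc ∣β∣≡1) (≡.cong (2 ℕ.+_) ∣β∣≡1))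
    (bumped-specs β (≡.cong suc ∣β∣≡1) (≡.cong (2 ℕ.+_) ∣β∣≡1))
    λ e₁ e₂ → ⊥-elim (J≉0 (trans (sym jet) (x*y≈0⇒y≈0 (ρ≉0 1≤m) (z₁-diff lin m 2 _ e₁ e₂))))
    where
    lin = ⟪⟫-linear P
    ss : Vec (Spec m) _
    ss = spec₁ 1 (s≤s z≤n) ∷ spec₀ 0 ∷ specs β
    ords₀≡ : ords₀ ss ≡ 1 ∷ 0 ∷ β
    ords₀≡ = ≡.cong (λ γ → 1 ∷ 0 ∷ γ) (ords₀-specs {m} β)
    jet : ⟪ P ⟫ (D 0# 0 ⊗ ⨂ (Vec.map z-of ss)) ≈ Jet P adm (0 ∷ 1 ∷ 0 ∷ β)
    jet = trans
      (L-z≈L-𝔻 (L-⊗ lin (D 0# 0)) ss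
        (λ js lt → Jet-low P adm (0 ∷ js) (≡.subst (∣ js ∣ ℕ.<_) (≡.trans (≡.cong ∣_∣ ords₀≡) ∣β∣≡1) lt)))
      (reflexive (≡.cong (λ γ → Jet P adm (0 ∷ γ)) ords₀≡))
  -- In the difference of the two `z₂` the value term has index (0, 0, β) of order 0 < l and drops
  -- out.
  ... | (1 ∷ 0 ∷ β , ∣β∣≡1 , J≉0) = both P adm
    (spec₂ 2 (s≤s (s≤s z≤n)) ∷ spec₀ 1 ∷ specs β) (spec₂ 3 (s≤s (s≤s z≤n)) ∷ spec₀ 0 ∷ specs β)
    (bumped-specs β (≡.cong suc ∣β∣≡1) (≡.cong (2 ℕ.+_) ∣β∣≡1))
    (bumped-specs β (≡.cong suc ∣β∣≡1) (≡.cong (2 ℕ.+_) ∣β∣≡1))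
    λ e₁ e₂ → ⊥-elim (J≉0 (trans (sym jet₁) (x*y≈0⇒y≈0 (ρ≉0 1≤m)
      (trans (sym (trans (+-congˡ (*-0ʳ jet₀)) (+-identityʳ _))) (z₂-diff lin m 3 _ e₁ e₂)))))
    where
    lin = ⟪⟫-linear P
    ∣β∣≡0 : ∣ β ∣ ≡ 0
    ∣β∣≡0 = ℕₚ.suc-injective ∣β∣≡1
    jet : ∀ j → ⟪ P ⟫ (D 0# j ⊗ D 0# 0 ⊗ ⨂ (Vec.map z-of (specs {m} β))) ≈ Jet P adm (j ∷ 0 ∷ β)
    jet j = L-specs (L-⊗ (L-⊗ lin (D 0# j)) (D 0# 0)) β
      (λ js lt → ⊥-elim (ℕₚ.n≮0 (≡.subst (∣ js ∣ ℕ.<_) ∣β∣≡0 lt)))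
    jet₁ = jet 1
    jet₀ : ⟪ P ⟫ (D 0# 0 ⊗ D 0# 0 ⊗ ⨂ (Vec.map z-of (specs {m} β))) ≈ 0#
    jet₀ = trans (jet 0) (Jet-low P adm (0 ∷ 0 ∷ β) (s≤s (ℕₚ.≤-reflexive ∣β∣≡0)))

  -- Two relations link the coefficients X₀ at 0 and X₁ at (1, 0, ..., 0): ρ(X₁ + 2ρX₀) = 0 and ρX₁
  -- + (σ + 3ρ²)X₀ = 0. Subtracting leaves (σ + ρ²)X₀ = 0 with a positive factor.
  lower-4-0 : ∀ {m n} (P : Poly (3 ℕ.+ n)) → 1 ℕ.≤ m → Admissible m (3 ℕ.+ n) 4 0 P →
    DegAtLeast P (m ℕ.* (3 ℕ.+ n) ℕ.+ (m ℕ.+ 1) ℕ.* 3 ∸ 1)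
  lower-4-0 {m} P 1≤m adm with Jet-top P adm
  ... | (0 ∷ 0 ∷ 0 ∷ β , ∣β∣≡0 , J≉0) =
    both P adm
      -- The extra order moves from the third coordinate to the second, so `z₁` with p = 2 stays in
      -- the first: this gives X₁ + 2ρX₀.
      (spec₁ 1 (s≤s z≤n) ∷ spec₁ 1 (s≤s z≤n) ∷ spec₀ 1 ∷ specs β) (spec₁ 1 (s≤s z≤n) ∷ spec₁ 2 (s≤s z≤n) ∷ spec₀ 0 ∷ specs β)
      (bumped-specs β (≡.cong (2 ℕ.+_) ∣β∣≡0) (≡.cong (3 ℕ.+_) ∣β∣≡0))
      (bumped-specs β (≡.cong (2 ℕ.+_) ∣β∣≡0) (≡.cong (3 ℕ.+_) ∣β∣≡0))
    λ e₁ e₂ → both P adm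
      -- The extra order moves from the second coordinate to the first; p grows from 3 to 4, whence
      -- the 3ρ².
      (spec₂ 2 (s≤s (s≤s z≤n)) ∷ spec₀ 1 ∷ spec₀ 0 ∷ specs β) (spec₂ 3 (s≤s (s≤s z≤n)) ∷ spec₀ 0 ∷ spec₀ 0 ∷ specs β)
      (bumped-specs β (≡.cong (2 ℕ.+_) ∣β∣≡0) (≡.cong (3 ℕ.+_) ∣β∣≡0))
      (bumped-specs β (≡.cong (2 ℕ.+_) ∣β∣≡0) (≡.cong (3 ℕ.+_) ∣β∣≡0))
    λ e₃ e₄ → ⊥-elim (J≉0 (trans (sym jet₀) (x*y≈0⇒y≈0 (σ+ρ²≉0 1≤m)
      (combine (z₁-diff (L-⊗ lin _) m 2 _ e₁ e₂) (z₂-diff lin m 3 _ e₃ e₄)))))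
    where
    lin = ⟪⟫-linear P
    F : Form _
    F = D 0# 0 ⊗ ⨂ (Vec.map z-of (specs {m} β))
    X₀ = ⟪ P ⟫ (D 0# 0 ⊗ D 0# 0 ⊗ F)
    X₁ = ⟪ P ⟫ (D 0# 1 ⊗ D 0# 0 ⊗ F)
    jet₀ : X₀ ≈ Jet P adm (0 ∷ 0 ∷ 0 ∷ β)
    jet₀ = L-specs (L-⊗ (L-⊗ (L-⊗ lin (D 0# 0)) (D 0# 0)) (D 0# 0)) β
      (λ js lt → ⊥-elim (ℕₚ.n≮0 (≡.subst (∣ js ∣ ℕ.<_) ∣β∣≡0 lt)))
    combine : ρ m * ⟪ P ⟫ (z₁ m 2 ⊗ D 0# 0 ⊗ F) ≈ 0# →
      ρ m * X₁ + (σ m + (ι 3 * ρ m) * ρ m) * X₀ ≈ 0# → (σ m + ρ m * ρ m) * X₀ ≈ 0#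
    combine p q = begin
      (σ m + ρ m * ρ m) * X₀
        ≈⟨ solve 4 (λ s r x y → (s :+ r :* r) :* x :=
             (r :* y :+ (s :+ (con (+ 3) :* r) :* r) :* x) :+ :- (r :* (y :+ (con (+ 2) :* r) :* x))) refl (σ m) (ρ m) X₀ X₁ ⟩
      (ρ m * X₁ + (σ m + (ι 3 * ρ m) * ρ m) * X₀) + - (ρ m * (X₁ + (ι 2 * ρ m) * X₀))
        ≈⟨ +-cong q (-‿cong (trans (*-congˡ (sym (trans (L-⊕ lin _ _ _) (+-congˡ (L-⊙ lin _ _ _))))) p)) ⟩
      0# + - 0#
        ≈⟨ -‿inverseʳ 0# ⟩
      0# ∎

  -- The pairs (k, l) fall into l = k - 2, l = k - 3 and (4, 0); the bound on n provides the
  -- coordinates to compare.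
  lower-ii : ∀ m n k l (P : Poly n) → 1 ℕ.≤ m → 1 ℕ.≤ n → 2 ℕ.≤ k → Admissible m n k l P →
    l ℕ.≤ k ∸ 2 → k ℕ.≤ 4 → k ∸ 1 ℕ.≤ n → DegAtLeast P (m ℕ.* n ℕ.+ (m ℕ.+ 1) ℕ.* (k ∸ 1) ∸ 1)
  lower-ii m n 1 l P _ _ (s≤s ()) _ _ _ _
  lower-ii m n 2 0 P 1≤m 1≤n _ adm z≤n _ _ = lower-top P 1≤n adm
  lower-ii m _ 3 0 P 1≤m _ _ adm z≤n _ (s≤s (s≤s _)) with Jet-top P adm
  ... | (0 ∷ 0 ∷ β , ∣β∣≡0 , J≉0) = lower-00 P 1≤m adm β ∣β∣≡0 J≉0
  lower-ii m n 3 1 P 1≤m 1≤n _ adm (s≤s z≤n) _ _ = lower-top P 1≤n adm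
  lower-ii m _ 4 0 P 1≤m _ _ adm z≤n _ (s≤s (s≤s (s≤s _))) = lower-4-0 P 1≤m adm
  lower-ii m _ 4 1 P 1≤m _ _ adm (s≤s z≤n) _ (s≤s (s≤s (s≤s _))) = lower-4-1 P 1≤m adm
  lower-ii m n 4 2 P 1≤m 1≤n _ adm (s≤s (s≤s z≤n)) _ _ = lower-top P 1≤n adm
  lower-ii m n (suc (suc (suc (suc (suc k))))) l P _ _ _ _ _ (s≤s (s≤s (s≤s (s≤s ())))) _

  -- Univariate building blocks of the extremal polynomials

  sumTo : ℕ → Seq → Carrier
  sumTo zero    f = 0#
  sumTo (suc n) f = f 0 + sumTo n (f ∘ suc)

  sumTo-cong : ∀ n {f g} → (∀ q → q ℕ.< n → f q ≈ g q) → sumTo n f ≈ sumTo n g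
  sumTo-cong zero    f≈g = refl
  sumTo-cong (suc n) f≈g = +-cong (f≈g 0 (s≤s z≤n)) (sumTo-cong n (λ q q<n → f≈g (suc q) (s≤s q<n)))

  sumTo-0 : ∀ n {f} → (∀ q → q ℕ.< n → f q ≈ 0#) → sumTo n f ≈ 0#
  sumTo-0 zero    f≈0 = refl
  sumTo-0 (suc n) f≈0 = +-0 (f≈0 0 (s≤s z≤n)) (sumTo-0 n (λ q q<n → f≈0 (suc q) (s≤s q<n)))

  sumTo-+ : ∀ n f g → sumTo n (f ⊕ g) ≈ sumTo n f + sumTo n g
  sumTo-+ zero    f g = sym (+-identityʳ _)
  sumTo-+ (suc n) f g = trans (+-congˡ (sumTo-+ n _ _))
    (solve 4 (λ a b c d → (a :+ b) :+ (c :+ d) := (a :+ c) :+ (b :+ d)) refl _ _ _ _)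

  sumTo-*ʳ : ∀ n f k → sumTo n (λ q → f q * k) ≈ sumTo n f * k
  sumTo-*ʳ zero    f k = sym (zeroˡ _)
  sumTo-*ʳ (suc n) f k = trans (+-congˡ (sumTo-*ʳ n _ k)) (sym (distribʳ _ _ _))

  sumTo-*ˡ : ∀ n k f → sumTo n (k ⊙ f) ≈ k * sumTo n f
  sumTo-*ˡ zero    k f = sym (zeroʳ _)
  sumTo-*ˡ (suc n) k f = trans (+-congˡ (sumTo-*ˡ n k _)) (sym (distribˡ _ _ _))

  sumTo-snoc : ∀ n f → sumTo (suc n) f ≈ sumTo n f + f n
  sumTo-snoc zero    f = +-comm _ _
  sumTo-snoc (suc n) f = trans (+-congˡ (sumTo-snoc n (f ∘ suc))) (sym (+-assoc _ _ _))

  sumTo-tail : ∀ {n} N f → n ℕ.≤ N → (∀ q → n ℕ.≤ q → f q ≈ 0#) → sumTo N f ≈ sumTo n f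
  sumTo-tail N f z≤n       f≈0 = sumTo-0 N (λ q _ → f≈0 q z≤n)
  sumTo-tail (suc N) f (s≤s n≤N) f≈0 = +-congˡ (sumTo-tail N (f ∘ suc) n≤N (λ q n≤q → f≈0 (suc q) (s≤s n≤q)))

  ∑-applyUpTo : ∀ {a} {A : Set a} (f : A → Carrier) (g : ℕ → A) n → ∑ f (List.applyUpTo g n) ≡ sumTo n (f ∘ g)
  ∑-applyUpTo f g zero    = ≡.refl
  ∑-applyUpTo f g (suc n) = ≡.cong (λ z → f (g 0) + z) (∑-applyUpTo f (g ∘ suc) n)

  ∑-sumTo : ∀ {a} {A : Set a} n (f : A → Seq) xs → ∑ (λ x → sumTo n (f x)) xs ≈ sumTo n (λ q → ∑ (λ x → f x q) xs)
  ∑-sumTo n f []       = sym (sumTo-0 n (λ _ _ → refl))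
  ∑-sumTo n f (x ∷ xs) = trans (+-congˡ (∑-sumTo n f xs)) (sym (sumTo-+ n _ _))

  ∑-++ : ∀ {a} {A : Set a} (f : A → Carrier) xs ys → ∑ f (xs List.++ ys) ≈ ∑ f xs + ∑ f ys
  ∑-++ f []       ys = sym (+-identityˡ _)
  ∑-++ f (x ∷ xs) ys = trans (+-congˡ (∑-++ f xs ys)) (sym (+-assoc _ _ _))

  ∑-concatMap : ∀ {a b} {A : Set a} {B : Set b} (f : B → Carrier) (g : A → List B) xs →
    ∑ f (List.concatMap g xs) ≈ ∑ (λ x → ∑ f (g x)) xs
  ∑-concatMap f g []       = refl
  ∑-concatMap f g (x ∷ xs) = trans (∑-++ f (g x) _) (+-congˡ (∑-concatMap f g xs))

  ∑-map : ∀ {a b} {A : Set a} {B : Set b} (f : B → Carrier) (g : A → B) xs → ∑ f (List.map g xs) ≈ ∑ (f ∘ g) xs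
  ∑-map f g []       = refl
  ∑-map f g (x ∷ xs) = +-congˡ (∑-map f g xs)

  -- Univariate polynomials are lists of coefficients, constant term first;
  -- E b p j is the coefficient of xʲ in p(x + b).
  E : Carrier → List Carrier → Seq
  E b []      j       = 0#
  E b (x ∷ p) zero    = x + b * E b p 0
  E b (x ∷ p) (suc j) = b * E b p (suc j) + E b p j

  coefL : List Carrier → Seq
  coefL []      e       = 0#
  coefL (x ∷ p) zero    = x
  coefL (x ∷ p) (suc e) = coefL p e

  coefL-≥ : ∀ p e → List.length p ℕ.≤ e → coefL p e ≈ 0#
  coefL-≥ []      e       _        = refl
  coefL-≥ (x ∷ p) (suc e) (s≤s le) = coefL-≥ p e le

  -- Both sides obey the same recursion when a constant term is put in front. This links coefficient
  -- lists to the functionals `D`.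
  E-sum : ∀ b p j N → List.length p ℕ.≤ N → sumTo N (λ e → coefL p e * D b j e) ≈ E b p j
  E-sum b []      j       N       _        = sumTo-0 N (λ _ _ → zeroˡ _)
  E-sum b (x ∷ p) zero    (suc N) (s≤s le) = +-cong (trans (*-congˡ (D-0-0 b)) (*-identityʳ _)) (begin
    sumTo N (λ e → coefL p e * D b 0 (suc e))
      ≈⟨ sumTo-cong N (λ e _ → trans (*-congˡ (D-0-suc b e)) (solve 3 (λ u v w → u :* (v :* w) := v :* (u :* w)) refl _ _ _)) ⟩
    sumTo N (b ⊙ (λ e → coefL p e * D b 0 e))
      ≈⟨ sumTo-*ˡ N b _ ⟩
    b * sumTo N (λ e → coefL p e * D b 0 e)
      ≈⟨ *-congˡ (E-sum b p 0 N le) ⟩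
    b * E b p 0 ∎)
  E-sum b (x ∷ p) (suc j) (suc N) (s≤s le) = trans (+-congʳ (*-0ʳ (D-suc-0 b j))) (trans (+-identityˡ _) (begin
    sumTo N (λ e → coefL p e * D b (suc j) (suc e))
      ≈⟨ sumTo-cong N (λ e _ → trans (*-congˡ (D-suc-suc b j e))
           (solve 4 (λ u v w y → u :* (v :* w :+ y) := v :* (u :* w) :+ u :* y) refl _ _ _ _)) ⟩
    sumTo N (b ⊙ (λ e → coefL p e * D b (suc j) e) ⊕ (λ e → coefL p e * D b j e))
      ≈⟨ sumTo-+ N _ _ ⟩
    sumTo N (b ⊙ (λ e → coefL p e * D b (suc j) e)) + sumTo N (λ e → coefL p e * D b j e)
      ≈⟨ +-cong (trans (sumTo-*ˡ N b _) (*-congˡ (E-sum b p (suc j) N le))) (E-sum b p j N le) ⟩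
    b * E b p (suc j) + E b p j ∎))

  -- horner a x p = x + (X − a) p
  horner : Carrier → Carrier → List Carrier → List Carrier
  horner a x []      = x ∷ []
  horner a x (y ∷ p) = x + - (a * y) ∷ horner a y p

  length-horner : ∀ a x p → List.length (horner a x p) ≡ suc (List.length p)
  length-horner a x []      = ≡.refl
  length-horner a x (y ∷ p) = ≡.cong suc (length-horner a y p)

  E-horner-0 : ∀ b a x p → E b (horner a x p) 0 ≈ x + (b + - a) * E b p 0
  E-horner-0 b a x []      = +-congˡ (trans (zeroʳ _) (sym (zeroʳ _)))
  E-horner-0 b a x (y ∷ p) = trans (+-congˡ (*-congˡ (E-horner-0 b a y p)))
    (solve 5 (λ a b x y v → (x :+ :- (a :* y)) :+ b :* (y :+ (b :+ :- a) :* v) := x :+ (b :+ :- a) :* (y :+ b :* v))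
      refl a b x y (E b p 0))

  E-horner-suc : ∀ b a x p j → E b (horner a x p) (suc j) ≈ (b + - a) * E b p (suc j) + E b p j
  E-horner-suc b a x []      j       = +-congʳ (trans (zeroʳ _) (sym (zeroʳ _)))
  E-horner-suc b a x (y ∷ p) zero    = trans (+-cong (*-congˡ (E-horner-suc b a y p 0)) (E-horner-0 b a y p))
    (solve 5 (λ a b y u v → b :* ((b :+ :- a) :* u :+ v) :+ (y :+ (b :+ :- a) :* v)
        := (b :+ :- a) :* (b :* u :+ v) :+ (y :+ b :* v)) refl a b y (E b p 1) (E b p 0))
  E-horner-suc b a x (y ∷ p) (suc j) = trans (+-cong (*-congˡ (E-horner-suc b a y p (suc j))) (E-horner-suc b a y p j))
    (solve 5 (λ a b u v w → b :* ((b :+ :- a) :* u :+ v) :+ ((b :+ :- a) :* v :+ w)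
        := (b :+ :- a) :* (b :* u :+ v) :+ (b :* v :+ w)) refl a b (E b p (suc (suc j))) (E b p (suc j)) (E b p j))

  mulX : Carrier → List Carrier → List Carrier
  mulX a = horner a 0#

  E-mulX-0 : ∀ b a p → E b (mulX a p) 0 ≈ (b + - a) * E b p 0
  E-mulX-0 b a p = trans (E-horner-0 b a 0# p) (+-identityˡ _)

  Ord : Carrier → ℕ → List Carrier → Set ℓ
  Ord b r p = ∀ j → j ℕ.< r → E b p j ≈ 0#

  Ord-mulX : ∀ b a p {r} → Ord b r p → Ord b r (mulX a p)
  Ord-mulX b a p ord zero    0<r = trans (E-mulX-0 b a p) (*-0ʳ (ord 0 0<r))
  Ord-mulX b a p ord (suc j) j<r = trans (E-horner-suc b a 0# p j)
    (+-0 (*-0ʳ (ord (suc j) j<r)) (ord j (ℕₚ.<-trans (ℕₚ.n<1+n j) j<r)))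

  lead-mulX : ∀ b a p {r} → Ord b r p → E b (mulX a p) r ≈ (b + - a) * E b p r
  lead-mulX b a p {zero}  ord = E-mulX-0 b a p
  lead-mulX b a p {suc r} ord = trans (E-horner-suc b a 0# p r) (trans (+-congˡ (ord r (ℕₚ.n<1+n r))) (+-identityʳ _))

  Ord-mulX-same : ∀ b p {r} → Ord b r p → Ord b (suc r) (mulX b p)
  Ord-mulX-same b p ord zero    _         = trans (E-mulX-0 b b p) (*-0ˡ (-‿inverseʳ b))
  Ord-mulX-same b p ord (suc j) (s≤s j<r) = trans (E-horner-suc b b 0# p j)
    (+-0 (*-0ˡ (-‿inverseʳ b)) (ord j j<r))

  lead-mulX-same : ∀ b r p → E b (mulX b p) (suc r) ≈ E b p r
  lead-mulX-same b r p = trans (E-horner-suc b b 0# p r) (trans (+-congʳ (*-0ˡ (-‿inverseʳ b))) (+-identityˡ _))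

  -- Multiplication by x(x − 1)⋯(x − (c − 1)).
  mulPts : ℕ → List Carrier → List Carrier
  mulPts zero    p = p
  mulPts (suc c) p = mulX (ι c) (mulPts c p)

  length-mulPts : ∀ c p → List.length (mulPts c p) ≡ c ℕ.+ List.length p
  length-mulPts zero    p = ≡.refl
  length-mulPts (suc c) p = ≡.trans (length-horner (ι c) 0# (mulPts c p)) (≡.cong suc (length-mulPts c p))

  -- At t the factor x - a has the value t - a, or for a = t a simple zero with leading coefficient
  -- 1.
  factor : ℕ → ℕ → Carrier
  factor t a with a ℕ.≟ t
  ... | yes _ = 1#
  ... | no  _ = ι t + - ι a

  factor-≉0 : ∀ t a → factor t a ≉0
  factor-≉0 t a with a ℕ.≟ t
  ... | yes _   = 1≉0
  ... | no  a≢t = ι-diff-≉0 a≢t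

  -- The first nonzero Taylor coefficient at t of x(x - 1)⋯(x - (c - 1)).
  κ : ℕ → ℕ → Carrier
  κ t zero    = 1#
  κ t (suc c) = factor t c * κ t c

  κ-≉0 : ∀ t c → κ t c ≉0
  κ-≉0 t zero    = 1≉0
  κ-≉0 t (suc c) = *-≉0 (factor-≉0 t c) (κ-≉0 t c)

  mulPts-outside : ∀ t c p {r} → c ℕ.≤ t → Ord (ι t) r p →
    Ord (ι t) r (mulPts c p) × E (ι t) (mulPts c p) r ≈ κ t c * E (ι t) p r
  mulPts-outside t zero    p _   ord = ord , sym (*-identityˡ _)
  mulPts-outside t (suc c) p c<t ord with mulPts-outside t c p (ℕₚ.<⇒≤ c<t) ord | c ℕ.≟ t
  ... | (ord′ , lead) | yes c≡t = ⊥-elim (ℕₚ.<⇒≢ c<t c≡t)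
  ... | (ord′ , lead) | no  _   = Ord-mulX (ι t) (ι c) (mulPts c p) ord′ ,
    trans (lead-mulX (ι t) (ι c) (mulPts c p) ord′) (trans (*-congˡ lead) (sym (*-assoc _ _ _)))

  -- Exactly one of the factors vanishes at t, so the order rises by one.
  mulPts-inside : ∀ t c p {r} → t ℕ.< c → Ord (ι t) r p →
    Ord (ι t) (suc r) (mulPts c p) × E (ι t) (mulPts c p) (suc r) ≈ κ t c * E (ι t) p r
  mulPts-inside t (suc c) p {r} (s≤s t≤c) ord with c ℕ.≟ t
  ... | yes ≡.refl with mulPts-outside t c p ℕₚ.≤-refl ord
  ...   | (ord′ , lead) = Ord-mulX-same (ι t) (mulPts c p) ord′ ,
          trans (lead-mulX-same (ι t) r (mulPts c p)) (trans lead (*-congʳ (sym (*-identityˡ _))))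
  mulPts-inside t (suc c) p {r} (s≤s t≤c) ord | no c≢t with mulPts-inside t c p (ℕₚ.≤∧≢⇒< t≤c (c≢t ∘ ≡.sym)) ord
  ...   | (ord′ , lead) = Ord-mulX (ι t) (ι c) (mulPts c p) ord′ ,
          trans (lead-mulX (ι t) (ι c) (mulPts c p) ord′) (trans (*-congˡ lead) (sym (*-assoc _ _ _)))

  -- Multiplication by g^s, where g = x(x - 1)⋯(x - m).
  gpow : ℕ → ℕ → List Carrier → List Carrier
  gpow m zero    p = p
  gpow m (suc s) p = mulPts (suc m) (gpow m s p)

  length-gpow : ∀ m s p → List.length (gpow m s p) ≡ suc m ℕ.* s ℕ.+ List.length p
  length-gpow m zero    p = ≡.cong (ℕ._+ List.length p) (≡.sym (ℕₚ.*-zeroʳ m))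
  length-gpow m (suc s) p = ≡.trans (length-mulPts (suc m) _) (≡.trans (≡.cong (suc m ℕ.+_) (length-gpow m s p))
    (≡.trans (≡.sym (ℕₚ.+-assoc (suc m) _ _)) (≡.cong (ℕ._+ List.length p) (≡.sym (ℕₚ.*-suc (suc m) s)))))

  κpow : ℕ → ℕ → ℕ → Carrier
  κpow m t zero    = 1#
  κpow m t (suc s) = κ t (suc m) * κpow m t s

  κpow-≉0 : ∀ m t s → κpow m t s ≉0
  κpow-≉0 m t zero    = 1≉0
  κpow-≉0 m t (suc s) = *-≉0 (κ-≉0 t (suc m)) (κpow-≉0 m t s)

  gpow-lead : ∀ m t s p → t ℕ.≤ m → Ord (ι t) s (gpow m s p) × E (ι t) (gpow m s p) s ≈ κpow m t s * E (ι t) p 0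
  gpow-lead m t zero    p t≤m = (λ _ ()) , sym (*-identityˡ _)
  gpow-lead m t (suc s) p t≤m with gpow-lead m t s p t≤m
  ... | (ord , lead) with mulPts-inside t (suc m) (gpow m s p) (s≤s t≤m) ord
  ...   | (ord′ , lead′) = ord′ , trans lead′ (trans (*-congˡ lead) (sym (*-assoc _ _ _)))

  -- The products (x - 1)⋯(x - c) and interpolation at 1, ..., c.

  newton : ℕ → List Carrier
  newton zero    = 1# ∷ []
  newton (suc c) = mulX (ι (suc c)) (newton c)

  length-newton : ∀ c → List.length (newton c) ≡ suc c
  length-newton zero    = ≡.refl
  length-newton (suc c) = ≡.trans (length-horner (ι (suc c)) 0# (newton c)) (≡.cong suc (length-newton c))

  newton-root : ∀ c t → 1 ℕ.≤ t → t ℕ.≤ c → E (ι t) (newton c) 0 ≈ 0#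
  newton-root zero    t 1≤t t≤0 = ⊥-elim (ℕₚ.<⇒≱ 1≤t t≤0)
  newton-root (suc c) t 1≤t t≤c with t ℕ.≟ suc c
  ... | yes ≡.refl = trans (E-mulX-0 _ _ (newton c)) (*-0ˡ (-‿inverseʳ _))
  ... | no  t≢1+c  = trans (E-mulX-0 _ _ (newton c)) (*-0ʳ (newton-root c t 1≤t (ℕₚ.≤-pred (ℕₚ.≤∧≢⇒< t≤c t≢1+c))))

  newton-at-0 : ∀ c → E 0# (newton c) 0 ≉0
  newton-at-0 zero    eq = 1≉0 (trans (sym (trans (+-congˡ (zeroʳ _)) (+-identityʳ _))) eq)
  newton-at-0 (suc c) eq = *-≉0 (ι-diff-≉0 {suc c} {0} (λ ())) (newton-at-0 c) (trans (sym (E-mulX-0 0# _ (newton c))) eq)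

  -- Newton's scheme: h = v(c + 1) + (x - (c + 1)) h′, where h′ interpolates divided differences at
  -- 1, ..., c.
  interpolate : ∀ c (v : ℕ → Carrier) → ∃[ h ] (List.length h ≡ c × (∀ t → 1 ℕ.≤ t → t ℕ.≤ c → E (ι t) h 0 ≈ v t))
  interpolate zero    v = [] , ≡.refl , λ t 1≤t t≤0 → ⊥-elim (ℕₚ.<⇒≱ 1≤t t≤0)
  interpolate (suc c) v = h , ≡.trans (length-horner _ _ h′) (≡.cong suc (proj₁ (proj₂ ih))) , values
    where
    inv : ∀ t → Dec (suc c ≡ t) → Carrier
    -- A default value: h′ is prescribed at t ≤ c only.
    inv t (yes _)   = 0#
    inv t (no a≢t) = proj₁ (inverse _ (ι-diff-≉0 a≢t))
    v′ : ℕ → Carrier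
    v′ t = inv t (suc c ℕ.≟ t) * (v t + - v (suc c))
    ih = interpolate c v′
    h′ = proj₁ ih
    h = horner (ι (suc c)) (v (suc c)) h′
    values : ∀ t → 1 ℕ.≤ t → t ℕ.≤ suc c → E (ι t) h 0 ≈ v t
    values t 1≤t t≤1+c with suc c ℕ.≟ t | proj₂ (proj₂ ih) t 1≤t
    ... | yes ≡.refl | _   = trans (E-horner-0 _ _ _ h′) (trans (+-congˡ (*-0ˡ (-‿inverseʳ _))) (+-identityʳ _))
    ... | no  a≢t    | eq = trans (E-horner-0 _ _ _ h′) (begin
      v (suc c) + d * E (ι t) h′ 0
        ≈⟨ +-congˡ (*-congˡ (eq (ℕₚ.≤-pred (ℕₚ.≤∧≢⇒< t≤1+c (a≢t ∘ ≡.sym))))) ⟩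
      v (suc c) + d * (proj₁ d⁻¹ * (v t + - v (suc c)))
        ≈⟨ +-congˡ (trans (sym (*-assoc _ _ _)) (trans (*-congʳ (proj₂ d⁻¹)) (*-identityˡ _))) ⟩
      v (suc c) + (v t + - v (suc c))
        ≈⟨ solve 2 (λ x y → x :+ (y :+ :- x) := y) refl _ _ ⟩
      v t ∎)
      where
      d = ι t + - ι (suc c)
      d⁻¹ = inverse _ (ι-diff-≉0 a≢t)

  -- With g = x(x − 1)⋯(x − m): pol m s q = g^(s+q) h_q, where h_0 = (x − 1)⋯(x − m) and each
  -- further h_q, of degree < m, is chosen so that h_0 g^s + ⋯ + h_q g^(s+q) vanishes to order
  -- s + q + 1 at 1, …, m.
  mutual
    pol : ℕ → ℕ → ℕ → List Carrier
    pol m s zero    = gpow m s (newton m)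
    pol m s (suc q) = gpow m (s ℕ.+ suc q) (proj₁ (interpolate m (correction m s (suc q))))

    correction : ℕ → ℕ → ℕ → ℕ → Carrier
    correction m s q t = - partial m s q (ι t) (s ℕ.+ q) * proj₁ (inverse _ (κpow-≉0 m t (s ℕ.+ q)))

    partial : ℕ → ℕ → ℕ → Carrier → Seq
    partial m s zero    b j = 0#
    partial m s (suc q) b j = partial m s q b j + E b (pol m s q) j

  partial-sumTo : ∀ m s r b j → sumTo r (λ q → E b (pol m s q) j) ≈ partial m s r b j
  partial-sumTo m s zero    b j = refl
  partial-sumTo m s (suc r) b j = trans (sumTo-snoc r _) (+-congʳ (partial-sumTo m s r b j))

  pol-ord : ∀ m s q t → t ℕ.≤ m → Ord (ι t) (s ℕ.+ q) (pol m s q)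
  pol-ord m s zero    t t≤m = ≡.subst (λ r → Ord (ι t) r (pol m s 0)) (≡.sym (ℕₚ.+-identityʳ s)) (proj₁ (gpow-lead m t s (newton m) t≤m))
  pol-ord m s (suc q) t t≤m = proj₁ (gpow-lead m t (s ℕ.+ suc q) _ t≤m)

  -- A new summand leaves the lower orders intact. The one new order vanishes because t is a root of
  -- h_0 or, later on, by the choice of `correction`.
  partial-ord : ∀ m s r t → 1 ℕ.≤ t → t ℕ.≤ m → ∀ j → j ℕ.< s ℕ.+ r → partial m s r (ι t) j ≈ 0#
  partial-ord m s zero    t 1≤t t≤m j _ = refl
  partial-ord m s (suc r) t 1≤t t≤m j j<s+1+r with j ℕ.≟ s ℕ.+ r
  ... | no  j≢ = +-0 (partial-ord m s r t 1≤t t≤m j j<s+r) (pol-ord m s r t t≤m j j<s+r)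
    where j<s+r = ℕₚ.≤∧≢⇒< (ℕₚ.≤-pred (≡.subst (j ℕ.<_) (ℕₚ.+-suc s r) j<s+1+r)) j≢
  partial-ord m s (suc zero) t 1≤t t≤m _ _ | yes ≡.refl = +-0 refl (trans
    (reflexive (≡.cong (E (ι t) (pol m s 0)) (ℕₚ.+-identityʳ s)))
    (trans (proj₂ (gpow-lead m t s (newton m) t≤m)) (*-0ʳ (newton-root m t 1≤t t≤m))))
  partial-ord m s (suc (suc r)) t 1≤t t≤m _ _ | yes ≡.refl = begin
    S + E (ι t) (pol m s (suc r)) (s ℕ.+ suc r)
      ≈⟨ +-congˡ (proj₂ (gpow-lead m t (s ℕ.+ suc r) _ t≤m)) ⟩
    S + K * E (ι t) (proj₁ (interpolate m (correction m s (suc r)))) 0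
      ≈⟨ +-congˡ (*-congˡ (proj₂ (proj₂ (interpolate m (correction m s (suc r)))) t 1≤t t≤m)) ⟩
    S + K * (- S * proj₁ K⁻¹)
      ≈⟨ solve 3 (λ s k i → s :+ k :* (:- s :* i) := s :+ :- (s :* (k :* i))) refl S K (proj₁ K⁻¹) ⟩
    S + - (S * (K * proj₁ K⁻¹))
      ≈⟨ +-congˡ (-‿cong (trans (*-congˡ (proj₂ K⁻¹)) (*-identityʳ _))) ⟩
    S + - S
      ≈⟨ -‿inverseʳ S ⟩
    0# ∎
    where
    S = partial m s (suc r) (ι t) (s ℕ.+ suc r)
    K = κpow m t (s ℕ.+ suc r)
    K⁻¹ = inverse _ (κpow-≉0 m t (s ℕ.+ suc r))

  -- At 0 the polynomial g has a simple zero and h_0 none, so g^s h_0 has order exactly s.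
  pol-at-0 : ∀ m s → E 0# (pol m s 0) s ≉0
  pol-at-0 m s eq = *-≉0 (κpow-≉0 m 0 s) (newton-at-0 m) (trans (sym (proj₂ (gpow-lead m 0 s (newton m) z≤n))) eq)

  length-pol-0 : ∀ m s → List.length (pol m s 0) ≡ suc m ℕ.* s ℕ.+ suc m
  length-pol-0 m s = ≡.trans (length-gpow m s _) (≡.cong (suc m ℕ.* s ℕ.+_) (length-newton m))

  length-pol-suc : ∀ m s q → List.length (pol m s (suc q)) ≡ suc m ℕ.* (s ℕ.+ suc q) ℕ.+ m
  length-pol-suc m s q = ≡.trans (length-gpow m (s ℕ.+ suc q) _) (≡.cong (suc m ℕ.* (s ℕ.+ suc q) ℕ.+_)
    (proj₁ (proj₂ (interpolate m (correction m s (suc q))))))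

  -- The extremal polynomials

  -- T K (d₁ ∷ ⋯ ∷ dₙ) is the sum of d₁(γ₁)⋯dₙ(γₙ) over all γ with |γ| < K.
  T : ∀ {n} → ℕ → Vec Seq n → Carrier
  T K []       = if K ℕ.≡ᵇ 0 then 0# else 1#
  T K (d ∷ ds) = sumTo K (λ q → d q * T (K ∸ q) ds)

  T-cong : ∀ {n} K {ds ds′ : Vec Seq n} → Pointwise (λ d d′ → ∀ q → q ℕ.< K → d q ≈ d′ q) ds ds′ → T K ds ≈ T K ds′
  T-cong K eqs = go K ℕₚ.≤-refl eqs
    where
    -- The bound on |γ| shrinks to K′ along the vector, while agreement is assumed below the
    -- original K.
    go : ∀ {n} {ds ds′ : Vec Seq n} K′ → K′ ℕ.≤ K → Pointwise (λ d d′ → ∀ q → q ℕ.< K → d q ≈ d′ q) ds ds′ → T K′ ds ≈ T K′ ds′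
    go _  _    []         = refl
    go K′ K′≤K (eq ∷ eqs) = sumTo-cong K′ (λ q q<K′ →
      *-cong (eq q (ℕₚ.<-≤-trans q<K′ K′≤K)) (go (K′ ∸ q) (ℕₚ.≤-trans (ℕₚ.m∸n≤m K′ q) K′≤K) eqs))

  T-head-0 : ∀ {n} K d (ds : Vec Seq n) → (∀ q → d q ≈ 0#) → T K (d ∷ ds) ≈ 0#
  T-head-0 K d ds d≈0 = sumTo-0 K (λ q _ → *-0ˡ (d≈0 q))

  ∏sums : ∀ {n} → Vec ℕ n → Vec Seq n → Carrier
  ∏sums []      []       = 1#
  ∏sums (b ∷ β) (d ∷ ds) = sumTo (suc b) d * ∏sums β ds

  -- Nonzero terms have γ ≤ β componentwise, so |γ| ≤ |β| < K: the truncation removes none of them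
  -- and the sum factors.
  T-∏ : ∀ {n} K (β : Vec ℕ n) {ds} → Pointwise (λ b d → ∀ q → b ℕ.< q → d q ≈ 0#) β ds → ∣ β ∣ ℕ.< K → T K ds ≈ ∏sums β ds
  T-∏ (suc K) [] [] _ = refl
  T-∏ K (b ∷ β) {d ∷ ds} (d≈0 ∷ ds≈0) lt = begin
    sumTo K (λ q → d q * T (K ∸ q) ds)  ≈⟨ sumTo-cong K (λ q _ → term q) ⟩
    sumTo K (λ q → d q * ∏sums β ds)    ≈⟨ sumTo-*ʳ K d _ ⟩
    sumTo K d * ∏sums β ds              ≈⟨ *-congʳ (sumTo-tail K d (ℕₚ.≤-<-trans (ℕₚ.m≤m+n b _) lt) d≈0) ⟩
    sumTo (suc b) d * ∏sums β ds        ∎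
    where
    term : ∀ q → d q * T (K ∸ q) ds ≈ d q * ∏sums β ds
    term q with q ℕ.≤? b
    ... | yes q≤b = *-congˡ (T-∏ (K ∸ q) β ds≈0 (ℕₚ.m+n≤o⇒m≤o∸n (suc (∣ β ∣))
      (ℕₚ.≤-trans (s≤s (ℕₚ.≤-trans (ℕₚ.≤-reflexive (ℕₚ.+-comm (∣ β ∣) q)) (ℕₚ.+-monoˡ-≤ (∣ β ∣) q≤b))) lt)))
    ... | no  q≰b = trans (*-0ˡ (d≈0 q (ℕₚ.≰⇒> q≰b))) (sym (*-0ˡ (d≈0 q (ℕₚ.≰⇒> q≰b))))

  -- Truncated sums of products: their pairings and degrees.

  Fam : Set c
  Fam = ℕ → List Carrier

  coefs : ∀ {n} → Vec Fam n → Vec ℕ n → Vec Seq n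
  coefs = Vec.zipWith (λ f e q → coefL (f q) e)

  pairings : ∀ {n} → ℕ → Vec Fam n → Vec Seq n → Vec Seq n
  pairings B = Vec.zipWith (λ f φ q → ∑ (λ e → coefL (f q) e * φ e) (List.upTo (suc B)))

  -- For each fixed γ the sum over the box factors, one variable at a time.
  box-T : ∀ {n} B K (fs : Vec Fam n) (φs : Vec Seq n) →
    ∑ (λ α → T K (coefs fs α) * ⨂ φs α) (box B n) ≈ T K (pairings B fs φs)
  box-T B K [] [] = trans (+-identityʳ _) (*-identityʳ _)
  box-T {suc n} B K (f ∷ fs) (φ ∷ φs) = begin
    ∑ G (List.concatMap (λ e → List.map (e ∷_) (box B n)) es)
      ≈⟨ ∑-concatMap G (λ e → List.map (e ∷_) (box B n)) es ⟩
    ∑ (λ e → ∑ G (List.map (e ∷_) (box B n))) es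
      ≈⟨ ∑-cong (λ e → trans (∑-map G (e ∷_) (box B n)) (slice e)) es ⟩
    ∑ (λ e → sumTo K (λ q → (coefL (f q) e * φ e) * T (K ∸ q) ds)) es
      ≈⟨ ∑-sumTo K _ es ⟩
    sumTo K (λ q → ∑ (λ e → (coefL (f q) e * φ e) * T (K ∸ q) ds) es)
      ≈⟨ sumTo-cong K (λ q _ → trans (∑-cong (λ e → *-comm _ _) es) (trans (∑-* _ _ es) (*-comm _ _))) ⟩
    sumTo K (λ q → ∑ (λ e → coefL (f q) e * φ e) es * T (K ∸ q) ds) ∎
    where
    es = List.upTo (suc B)
    ds = pairings B fs φs
    G : Form (suc n)
    G α = T K (coefs (f ∷ fs) α) * ⨂ (φ ∷ φs) α
    slice : ∀ e → ∑ (λ α → G (e ∷ α)) (box B n) ≈ sumTo K (λ q → (coefL (f q) e * φ e) * T (K ∸ q) ds)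
    slice e = begin
      ∑ (λ α → sumTo K (λ q → coefL (f q) e * T (K ∸ q) (coefs fs α)) * (φ e * ⨂ φs α)) (box B n)
        ≈⟨ ∑-cong (λ α → trans (sym (sumTo-*ʳ K _ _)) (sumTo-cong K (λ q _ →
             solve 4 (λ u v w x → (u :* v) :* (w :* x) := (u :* w) :* (v :* x)) refl _ _ _ _))) (box B n) ⟩
      ∑ (λ α → sumTo K (λ q → (coefL (f q) e * φ e) * (T (K ∸ q) (coefs fs α) * ⨂ φs α))) (box B n)
        ≈⟨ ∑-sumTo K _ (box B n) ⟩
      sumTo K (λ q → ∑ (λ α → (coefL (f q) e * φ e) * (T (K ∸ q) (coefs fs α) * ⨂ φs α)) (box B n))
        ≈⟨ sumTo-cong K (λ q _ → trans (∑-* _ _ (box B n)) (*-congˡ (box-T B (K ∸ q) fs φs))) ⟩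
      sumTo K (λ q → (coefL (f q) e * φ e) * T (K ∸ q) ds) ∎

  jets : ∀ {n} → Vec Fam n → Vec ℕ n → Vec ℕ n → Vec Seq n
  jets []       []       []      = []
  jets (f ∷ fs) (b ∷ bs) (j ∷ β) = (λ q → E (ι b) (f q) j) ∷ jets fs bs β

  Short : ℕ → ℕ → Fam → Set
  Short K B f = ∀ q → q ℕ.< K → List.length (f q) ℕ.≤ suc B

  pairings≈jets : ∀ {n} B K (fs : Vec Fam n) bs β → All (Short K B) fs →
    Pointwise (λ d d′ → ∀ q → q ℕ.< K → d q ≈ d′ q) (pairings B fs (Vec.zipWith (λ b j → D (ι b) j) bs β)) (jets fs bs β)
  pairings≈jets B K []       []       []      []           = []
  pairings≈jets B K (f ∷ fs) (b ∷ bs) (j ∷ β) (sh ∷ shs) =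
    (λ q q<K → trans (reflexive (∑-applyUpTo _ id (suc B))) (E-sum (ι b) (f q) j (suc B) (sh q q<K)))
      ∷ pairings≈jets B K fs bs β shs

  -- Lengths are degrees plus one: the degree is at most s + m for q = 0, but at most s + (m + 1)q +
  -- m - 1 for q ≥ 1. This gap gives the sharper degree bound.
  Profile : ℕ → ℕ → Fam → Set
  Profile m s f = List.length (f 0) ℕ.≤ s ℕ.+ suc m × (∀ q → List.length (f (suc q)) ℕ.≤ s ℕ.+ suc m ℕ.* suc q ℕ.+ m)

  pol-Profile : ∀ m s → Profile m (suc m ℕ.* s) (pol m s)
  pol-Profile m s = ℕₚ.≤-reflexive (length-pol-0 m s) ,
    λ q → ℕₚ.≤-reflexive (≡.trans (length-pol-suc m s q) (≡.cong (ℕ._+ m) (ℕₚ.*-distribˡ-+ (suc m) s (suc q))))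

  Profile-≤ : ∀ {m s f} → Profile m s f → ∀ q → List.length (f q) ℕ.≤ s ℕ.+ suc m ℕ.* q ℕ.+ suc m
  Profile-≤ {m} {s} {f} (p₀ , p₊) zero    = ≡.subst (λ z → List.length (f 0) ℕ.≤ s ℕ.+ z ℕ.+ suc m) (≡.sym (ℕₚ.*-zeroʳ (suc m)))
    (≡.subst (λ z → List.length (f 0) ℕ.≤ z ℕ.+ suc m) (≡.sym (ℕₚ.+-identityʳ s)) p₀)
  Profile-≤ {m} {s} {f} (p₀ , p₊) (suc q) = ℕₚ.≤-trans (p₊ q) (ℕₚ.+-monoʳ-≤ _ (ℕₚ.n≤1+n m))

  private
    split-sum : ∀ m n s S q r → s ℕ.+ S ℕ.+ m ℕ.* suc n ℕ.+ suc m ℕ.* (q ℕ.+ r)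
      ≡ (s ℕ.+ suc m ℕ.* q ℕ.+ m) ℕ.+ (S ℕ.+ m ℕ.* n ℕ.+ suc m ℕ.* r)
    split-sum = solve-∀

    cancel : ∀ {e a x y} → e ℕ.≤ x → x ℕ.+ y ℕ.< e ℕ.+ a → y ℕ.< a
    cancel {e} {a} {x} {y} e≤x lt = ℕₚ.+-cancelˡ-< e y a (ℕₚ.≤-<-trans (ℕₚ.+-monoˡ-≤ y e≤x) lt)

    cancel′ : ∀ {e a x y} → e ℕ.≤ x → x ℕ.+ y ℕ.≤ e ℕ.+ a → y ℕ.≤ a
    cancel′ {e} {a} {x} {y} e≤x le = ℕₚ.+-cancelˡ-≤ e y a (ℕₚ.≤-trans (ℕₚ.+-monoˡ-≤ y e≤x) le)

    cancel″ : ∀ {e a x y} → e ℕ.< x → x ℕ.+ y ℕ.≤ e ℕ.+ a → y ℕ.< a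
    cancel″ {e} {a} {x} {y} e<x le = ℕₚ.+-cancelˡ-< e y a (ℕₚ.≤-trans (ℕₚ.+-monoˡ-≤ y e<x) le)

    suc-∸ : ∀ {q K} → q ℕ.≤ K → suc K ∸ q ≡ suc (K ∸ q)
    suc-∸ = ℕₚ.+-∸-assoc 1

  -- Where the q-th member contributes at exponent e, e ≤ s + (m + 1)q + m, and the remaining
  -- exponents are too large for the budget K - q.
  T-degree : ∀ {m n} K {ss : Vec ℕ n} {fs : Vec Fam n} → Pointwise (Profile m) ss fs → ∀ α →
    ∣ ss ∣ ℕ.+ m ℕ.* n ℕ.+ suc m ℕ.* K ℕ.< ∣ α ∣ → T (suc K) (coefs fs α) ≈ 0#
  T-degree {m} {suc n} K {s ∷ ss} {f ∷ fs} (p ∷ ps) (e ∷ α) lt = sumTo-0 (suc K) λ { q (s≤s q≤K) → term q q≤K }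
    where
    term : ∀ q → q ℕ.≤ K → coefL (f q) e * T (suc K ∸ q) (coefs fs α) ≈ 0#
    term q q≤K with List.length (f q) ℕ.≤? e
    ... | yes len≤e = *-0ˡ (coefL-≥ (f q) e len≤e)
    ... | no  len≰e = *-0ʳ (trans (reflexive (≡.cong (λ z → T z (coefs fs α)) (suc-∸ q≤K))) (T-degree (K ∸ q) ps α
      (cancel (ℕₚ.≤-pred (ℕₚ.≤-trans (ℕₚ.≰⇒> len≰e) (ℕₚ.≤-trans (Profile-≤ {f = f} p q) (ℕₚ.≤-reflexive (ℕₚ.+-suc _ m)))))
        (≡.subst (ℕ._< e ℕ.+ ∣ α ∣)
          (≡.trans (≡.cong (λ z → s ℕ.+ ∣ ss ∣ ℕ.+ m ℕ.* suc n ℕ.+ suc m ℕ.* z) (≡.sym (ℕₚ.m+[n∸m]≡n q≤K)))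
                   (split-sum m n s (∣ ss ∣) q (K ∸ q))) lt))))
  T-degree K [] [] ()

  -- Every γ ≠ 0 has a factor h_q with q ≥ 1, which saves one degree.
  T-degree-sharp : ∀ {m n} K {ss : Vec ℕ n} {fs : Vec Fam n} → Pointwise (Profile m) ss fs → ∀ α →
    ∣ ss ∣ ℕ.+ m ℕ.* n ℕ.+ suc m ℕ.* suc K ℕ.≤ ∣ α ∣ → T (suc (suc K)) (coefs fs α) ≈ 0#
  T-degree-sharp {m} K [] [] le = ⊥-elim (ℕₚ.n≮0 (≡.subst (ℕ._≤ 0) (≡.cong (ℕ._+ suc m ℕ.* suc K) (ℕₚ.*-zeroʳ m)) le))
  T-degree-sharp {m} {suc n} K {s ∷ ss} {f ∷ fs} (p ∷ ps) (e ∷ α) le =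
    -- The case γ₁ = 0 passes the saving on to the other variables; γ₁ ≥ 1 saves a degree at once,
    -- and `T-degree` handles the rest.
    +-0 term₀ (sumTo-0 (suc K) λ { q (s≤s q≤K) → term₊ q q≤K })
    where
    term₀ : coefL (f 0) e * T (suc (suc K)) (coefs fs α) ≈ 0#
    term₀ with List.length (f 0) ℕ.≤? e
    ... | yes len≤e = *-0ˡ (coefL-≥ (f 0) e len≤e)
    ... | no  len≰e = *-0ʳ (T-degree-sharp K ps α
      (cancel′ (ℕₚ.≤-pred (ℕₚ.≤-trans (ℕₚ.≰⇒> len≰e) (ℕₚ.≤-trans (Profile-≤ {f = f} p 0) (ℕₚ.≤-reflexive (ℕₚ.+-suc _ m)))))
        (≡.subst (ℕ._≤ e ℕ.+ ∣ α ∣) (split-sum m n s (∣ ss ∣) 0 (suc K)) le)))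
    term₊ : ∀ q → q ℕ.≤ K → coefL (f (suc q)) e * T (suc K ∸ q) (coefs fs α) ≈ 0#
    term₊ q q≤K with List.length (f (suc q)) ℕ.≤? e
    ... | yes len≤e = *-0ˡ (coefL-≥ (f (suc q)) e len≤e)
    ... | no  len≰e = *-0ʳ (trans (reflexive (≡.cong (λ z → T z (coefs fs α)) (suc-∸ q≤K))) (T-degree (K ∸ q) ps α
      (cancel″ (ℕₚ.≤-trans (ℕₚ.≰⇒> len≰e) (proj₂ p q))
        (≡.subst (ℕ._≤ e ℕ.+ ∣ α ∣)
          (≡.trans (≡.cong (λ z → s ℕ.+ ∣ ss ∣ ℕ.+ m ℕ.* suc n ℕ.+ suc m ℕ.* suc z) (≡.sym (ℕₚ.m+[n∸m]≡n q≤K)))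
                   (split-sum m n s (∣ ss ∣) (suc q) (K ∸ q))) le))))

  ∣replicate-0∣ : ∀ n {z} → z ≡ 0 → ∣ Vec.replicate n z ∣ ≡ 0
  ∣replicate-0∣ zero    _      = ≡.refl
  ∣replicate-0∣ (suc n) ≡.refl = ∣replicate-0∣ n ≡.refl

  -- Taylor coefficients of the univariate sums at the grid points.

  module _ (m : ℕ) where

    jets-support : ∀ {n} (bs β : Vec ℕ n) → All (ℕ._≤ m) bs →
      Pointwise (λ b d → ∀ q → b ℕ.< q → d q ≈ 0#) β (jets (Vec.replicate n (pol m 0)) bs β)
    jets-support []       []      []           = []
    jets-support (b ∷ bs) (j ∷ β) (b≤m ∷ bs≤m) = (λ q j<q → pol-ord m 0 q b b≤m j j<q) ∷ jets-support bs β bs≤m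

    sums-vanish : ∀ l b i → 1 ℕ.≤ b → b ℕ.≤ m → sumTo (suc i) (λ q → E (ι b) (pol m l q) (l ℕ.+ i)) ≈ 0#
    sums-vanish l b i 1≤b b≤m = trans (partial-sumTo m l (suc i) (ι b) (l ℕ.+ i))
      (partial-ord m l (suc i) b 1≤b b≤m (l ℕ.+ i) (ℕₚ.+-monoʳ-< l (ℕₚ.n<1+n i)))

    ∏sums-vanish : ∀ {n} (bs β : Vec ℕ n) → All (ℕ._≤ m) bs → bs ≢ Vec.replicate n 0 →
      ∏sums β (jets (Vec.replicate n (pol m 0)) bs β) ≈ 0#
    ∏sums-vanish []           []      []           bs≢0 = ⊥-elim (bs≢0 ≡.refl)
    ∏sums-vanish (zero ∷ bs)  (j ∷ β) (b≤m ∷ bs≤m) bs≢0 = *-0ʳ (∏sums-vanish bs β bs≤m (bs≢0 ∘ ≡.cong (0 ∷_)))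
    ∏sums-vanish (suc b ∷ bs) (j ∷ β) (b≤m ∷ bs≤m) bs≢0 = *-0ˡ (sums-vanish 0 (suc b) j (s≤s z≤n) b≤m)

    ∏sums-at-0 : ∀ n → ∏sums (Vec.replicate n 0) (jets (Vec.replicate n (pol m 0)) (Vec.replicate n 0) (Vec.replicate n 0)) ≉0
    ∏sums-at-0 zero    = 1≉0
    ∏sums-at-0 (suc n) = *-≉0 (λ eq → pol-at-0 m 0 (trans (sym (+-identityʳ _)) eq)) (∏sums-at-0 n)

  -- The multiplicity on the grid is l + K + 1; the factor g^l sits in the first variable only.
  module Extremal (m n l K : ℕ) where

    fams : Vec Fam (suc n)
    fams = pol m l ∷ Vec.replicate n (pol m 0)

    shifts : Vec ℕ (suc n)
    shifts = suc m ℕ.* l ∷ Vec.replicate n (suc m ℕ.* 0)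

    profiles : Pointwise (Profile m) shifts fams
    profiles = pol-Profile m l ∷ go n
      where
      go : ∀ n → Pointwise (Profile m) (Vec.replicate n (suc m ℕ.* 0)) (Vec.replicate n (pol m 0))
      go zero    = []
      go (suc n) = pol-Profile m 0 ∷ go n

    top : ℕ
    top = m ℕ.* suc n ℕ.+ (m ℕ.+ 1) ℕ.* (l ℕ.+ K)

    top≡ : ∣ shifts ∣ ℕ.+ m ℕ.* suc n ℕ.+ suc m ℕ.* K ≡ top
    top≡ = ≡.trans (≡.cong (λ z → suc m ℕ.* l ℕ.+ z ℕ.+ m ℕ.* suc n ℕ.+ suc m ℕ.* K) (∣replicate-0∣ n (ℕₚ.*-zeroʳ m)))
      (rearrange m n l K)
      where
      rearrange : ∀ m n l K → suc m ℕ.* l ℕ.+ 0 ℕ.+ m ℕ.* suc n ℕ.+ suc m ℕ.* K ≡ m ℕ.* suc n ℕ.+ (m ℕ.+ 1) ℕ.* (l ℕ.+ K)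
      rearrange = solve-∀

    degree-≤ : ∀ α → top ℕ.< ∣ α ∣ → T (suc K) (coefs fams α) ≈ 0#
    degree-≤ α lt = T-degree K profiles α (≡.subst (ℕ._< ∣ α ∣) (≡.sym top≡) lt)

    B : ℕ
    -- Large enough for the degree of every univariate factor, as `pol-Short` requires.
    B = top ℕ.+ m

    poly : Poly (suc n)
    poly = record
      { coef   = λ α → T (suc K) (coefs fams α)
      ; bound  = B
      ; finite = λ α lt → degree-≤ α (ℕₚ.≤-<-trans (ℕₚ.m≤m+n top m) lt)
      }

    pol-Short : ∀ s → s ℕ.≤ l → Short (suc K) B (pol m s)
    pol-Short s s≤l q (s≤s q≤K) = ℕₚ.≤-trans (Profile-≤ {f = pol m s} (pol-Profile m s) q)
      (ℕₚ.≤-trans (ℕₚ.+-monoˡ-≤ (suc m) (ℕₚ.+-mono-≤ (ℕₚ.*-monoʳ-≤ (suc m) s≤l) (ℕₚ.*-monoʳ-≤ (suc m) q≤K)))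
        (ℕₚ.≤-trans (ℕₚ.m≤n+m _ (m ℕ.* suc n)) (ℕₚ.≤-reflexive (rearrange m n l K))))
      where
      rearrange : ∀ m n l K → m ℕ.* suc n ℕ.+ (suc m ℕ.* l ℕ.+ suc m ℕ.* K ℕ.+ suc m)
        ≡ suc (m ℕ.* suc n ℕ.+ (m ℕ.+ 1) ℕ.* (l ℕ.+ K) ℕ.+ m)
      rearrange = solve-∀

    fams-Short : All (Short (suc K) B) fams
    fams-Short = pol-Short l ℕₚ.≤-refl ∷ go n
      where
      go : ∀ n → All (Short (suc K) B) (Vec.replicate n (pol m 0))
      go zero    = []
      go (suc n) = pol-Short 0 z≤n ∷ go n

    value : ∀ bs β → ⟪ poly ⟫ (𝔻 bs β) ≈ T (suc K) (jets fams bs β)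
    value bs β = trans (box-T B (suc K) fams (Vec.zipWith (λ b j → D (ι b) j) bs β)) (T-cong (suc K) (pairings≈jets B (suc K) fams bs β fams-Short))

    value-low : ∀ b bs j β → b ℕ.≤ m → j ℕ.< l → ⟪ poly ⟫ (𝔻 (b ∷ bs) (j ∷ β)) ≈ 0#
    value-low b bs j β b≤m j<l = trans (value (b ∷ bs) (j ∷ β))
      (T-head-0 (suc K) _ (jets (Vec.replicate n (pol m 0)) bs β)
        (λ q → pol-ord m l q b b≤m j (ℕₚ.<-≤-trans j<l (ℕₚ.m≤m+n l q))))

    -- Up to total order l + K the truncation is invisible.
    value-∏ : ∀ b bs i β → b ℕ.≤ m → All (ℕ._≤ m) bs → i ℕ.+ ∣ β ∣ ℕ.≤ K →
      ⟪ poly ⟫ (𝔻 (b ∷ bs) (l ℕ.+ i ∷ β)) ≈ ∏sums (i ∷ β) (jets fams (b ∷ bs) (l ℕ.+ i ∷ β))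
    value-∏ b bs i β b≤m bs≤m le = trans (value (b ∷ bs) (l ℕ.+ i ∷ β)) (T-∏ (suc K) (i ∷ β)
      ((λ q i<q → pol-ord m l q b b≤m (l ℕ.+ i) (ℕₚ.+-monoʳ-< l i<q)) ∷ jets-support m bs β bs≤m) (s≤s le))

    -- Orders j < l in the first variable are killed by g^l; otherwise a nonzero coordinate makes
    -- one univariate sum in the product vanish.
    value-away : ∀ b bs j β → b ℕ.≤ m → All (ℕ._≤ m) bs → b ∷ bs ≢ Vec.replicate (suc n) 0 → j ℕ.+ ∣ β ∣ ℕ.≤ l ℕ.+ K →
      ⟪ poly ⟫ (𝔻 (b ∷ bs) (j ∷ β)) ≈ 0#
    value-away b bs j β b≤m bs≤m ≢0 le with j ℕ.<? l
    ... | yes j<l = value-low b bs j β b≤m j<l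
    ... | no  j≮l = ≡.subst (λ j → ⟪ poly ⟫ (𝔻 (b ∷ bs) (j ∷ β)) ≈ 0#) l+i≡j
      (trans (value-∏ b bs i β b≤m bs≤m (ℕₚ.+-cancelˡ-≤ l _ _ (≡.subst (ℕ._≤ l ℕ.+ K)
        (≡.trans (≡.cong (ℕ._+ ∣ β ∣) (≡.sym l+i≡j)) (ℕₚ.+-assoc l i _)) le))) (∏≈0 b b≤m ≢0))
      where
      i = j ∸ l
      l+i≡j = ℕₚ.m+[n∸m]≡n (ℕₚ.≮⇒≥ j≮l)
      ∏≈0 : ∀ b → b ℕ.≤ m → b ∷ bs ≢ Vec.replicate (suc n) 0 → ∏sums (i ∷ β) (jets fams (b ∷ bs) (l ℕ.+ i ∷ β)) ≈ 0#
      ∏≈0 zero    _   ≢0 = *-0ʳ (∏sums-vanish m bs β bs≤m (≢0 ∘ ≡.cong (0 ∷_)))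
      ∏≈0 (suc b) b≤m _  = *-0ˡ (sums-vanish m l (suc b) i (s≤s z≤n) b≤m)

    0≤m : ∀ n → All (ℕ._≤ m) (Vec.replicate n 0)
    0≤m zero    = []
    0≤m (suc n) = z≤n ∷ 0≤m n

    admissible : ∀ {k} → k ≡ suc (l ℕ.+ K) → Admissible m (suc n) k l poly
    -- The index (l, 0, ..., 0) picks the lowest coefficient of g^l h_0 times values h_0(0), all
    -- nonzero.
    admissible ≡.refl = away , low , l ∷ Vec.replicate n 0 , ∣l0∣≡l , exact
      where
      away : ∀ bs → All (ℕ._≤ m) bs → bs ≢ Vec.replicate (suc n) 0 → MultAtLeast poly (Vec.map ι bs) (suc (l ℕ.+ K))
      away (b ∷ bs) (b≤m ∷ bs≤m) ≢0 (j ∷ β) (s≤s le) =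
        trans (shiftCoef-𝔻 poly (b ∷ bs) (j ∷ β)) (value-away b bs j β b≤m bs≤m ≢0 le)
      low : MultAtLeast poly (Vec.replicate (suc n) 0#) l
      low (j ∷ β) lt = trans (shiftCoef-0 poly (j ∷ β))
        (value-low 0 (Vec.replicate n 0) j β z≤n (ℕₚ.≤-<-trans (ℕₚ.m≤m+n j _) lt))
      ∣l0∣≡l : l ℕ.+ ∣ Vec.replicate n 0 ∣ ≡ l
      ∣l0∣≡l = ≡.trans (≡.cong (l ℕ.+_) (∣replicate-0∣ n ≡.refl)) (ℕₚ.+-identityʳ l)
      exact : shiftCoef poly (Vec.replicate (suc n) 0#) (l ∷ Vec.replicate n 0) ≉0
      exact s≈0 = *-≉0 {sumTo 1 (λ q → E 0# (pol m l q) (l ℕ.+ 0))}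
        (λ eq → pol-at-0 m l (trans (reflexive (≡.cong (E 0# (pol m l 0)) (≡.sym (ℕₚ.+-identityʳ l))))
                  (trans (sym (+-identityʳ _)) eq)))
        (∏sums-at-0 m n)
        (trans (sym (value-∏ 0 (Vec.replicate n 0) 0 (Vec.replicate n 0) z≤n (0≤m n)
                 (ℕₚ.≤-trans (ℕₚ.≤-reflexive (∣replicate-0∣ n ≡.refl)) z≤n)))
          (trans (reflexive (≡.cong (λ j → ⟪ poly ⟫ (𝔻 (Vec.replicate (suc n) 0) (j ∷ Vec.replicate n 0))) (ℕₚ.+-identityʳ l)))
            (trans (sym (shiftCoef-0 poly _)) s≈0)))

  sharp-i : ∀ m n k l → 1 ℕ.≤ m → 1 ℕ.≤ n → 2 ℕ.≤ k → l ≡ k ∸ 1 →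
    ∃[ P ] (Admissible m n k l P × DegEq P (m ℕ.* n ℕ.+ (m ℕ.+ 1) ℕ.* (k ∸ 1)))
  sharp-i m (suc n) (suc k) .k 1≤m 1≤n 2≤k ≡.refl =
    poly , adm , lower-i m (suc n) (suc k) k poly 1≤m 1≤n 2≤k adm ≡.refl ,
    λ α lt → degree-≤ α (≡.subst (λ z → m ℕ.* suc n ℕ.+ (m ℕ.+ 1) ℕ.* z ℕ.< ∣ α ∣) (≡.sym (ℕₚ.+-identityʳ k)) lt)
    where
    -- With K = 0 only γ = 0 remains: the polynomial is g(x₁)^l ∏ᵢ h_0(xᵢ).
    open Extremal m n k 0
    adm = admissible (≡.cong suc (≡.sym (ℕₚ.+-identityʳ k)))

  sharp-ii : ∀ m n k l → 1 ℕ.≤ m → 1 ℕ.≤ n → 2 ℕ.≤ k → l ℕ.≤ k ∸ 2 → k ℕ.≤ 4 → k ∸ 1 ℕ.≤ n →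
    ∃[ P ] (Admissible m n k l P × DegEq P (m ℕ.* n ℕ.+ (m ℕ.+ 1) ℕ.* (k ∸ 1) ∸ 1))
  sharp-ii m n 1 l _ _ (s≤s ())
  sharp-ii m (suc n) (suc (suc k)) l 1≤m 1≤n 2≤k l≤k k≤4 k≤n =
    poly , adm , lower-ii m (suc n) (suc (suc k)) l poly 1≤m 1≤n 2≤k adm l≤k k≤4 k≤n ,
    λ α lt → T-degree-sharp (k ∸ l) profiles α (≡.subst (ℕ._≤ ∣ α ∣) (≡.sym total) (pred-<⇒≤ _ lt))
    where
    -- Here `k` is the multiplicity minus 2, so K = k - l + 1 makes l + K + 1 the multiplicity.
    open Extremal m n l (suc (k ∸ l))
    l+K≡ : l ℕ.+ suc (k ∸ l) ≡ suc k
    l+K≡ = ≡.trans (ℕₚ.+-suc l _) (≡.cong suc (ℕₚ.m+[n∸m]≡n l≤k))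
    adm = admissible (≡.cong suc (≡.sym l+K≡))
    total = ≡.trans top≡ (≡.cong (λ z → m ℕ.* suc n ℕ.+ (m ℕ.+ 1) ℕ.* z) l+K≡)
    pred-<⇒≤ : ∀ d {a} → d ∸ 1 ℕ.< a → d ℕ.≤ a
    pred-<⇒≤ zero    _  = z≤n
    pred-<⇒≤ (suc d) lt = lt

open import Data.Nat using (ℕ; _+_; _*_; _∸_; _≤_)

theorem1p5 : ∀ {c ℓ} (ℝ : RealField c ℓ) → let open WithReals ℝ in
    (∀ (m n k l : ℕ) (P : Poly n) → 1 ≤ m → 1 ≤ n → 2 ≤ k →
    Admissible m n k l P → l ≡ k ∸ 1 →
    DegAtLeast P (m * n + (m + 1) * (k ∸ 1)))
    × (∀ (m n k l : ℕ) (P : Poly n) → 1 ≤ m → 1 ≤ n → 2 ≤ k →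
    Admissible m n k l P → l ≤ k ∸ 2 → k ≤ 4 → k ∸ 1 ≤ n →
    DegAtLeast P (m * n + (m + 1) * (k ∸ 1) ∸ 1))
    × (∀ (m n k l : ℕ) → 1 ≤ m → 1 ≤ n → 2 ≤ k → l ≡ k ∸ 1 →
    ∃[ P ] (Admissible m n k l P × DegEq P (m * n + (m + 1) * (k ∸ 1))))
    × (∀ (m n k l : ℕ) → 1 ≤ m → 1 ≤ n → 2 ≤ k →
    l ≤ k ∸ 2 → k ≤ 4 → k ∸ 1 ≤ n →
    ∃[ P ] (Admissible m n k l P × DegEq P (m * n + (m + 1) * (k ∸ 1) ∸ 1)))
theorem1p5 ℝ = lower-i , lower-ii , sharp-i , sharp-ii
  where open Proof ℝ
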